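{- Let $G$ be a finite simple graph. Suppose that $G$ is not a $2$-cograph but every proper induced minor of $G$ and every proper induced minor of $\overline{G}$ is a $2$-cograph. Then $5 \leq |V(G)| \leq 10$.
   Context: All graphs are finite and simple; $\overline{G}$ denotes the complement of $G$. A graph is $2$-connected if it has at least three vertices, is connected, and has no cut vertex. A graph $G$ is a $2$-cograph if $G$ has no induced subgraph $H$ such that both $H$ and $\overline{H}$ are $2$-connected (in particular $K_1$ is a $2$-cograph). For an edge $e$ of $G$, $G/e$ denotes the simple graph obtained by contracting $e$ and then deleting all but one edge from each class of parallel edges. An induced minor of $G$ is a graph obtained from $G$ by a sequence of vertex deletions and edge contractions; it is proper if it is not $G$ itself (i.e. at least one deletion or contraction is performed). -}

module Defs where

open import Data.Nat using (ℕ; zero; suc; _≤_)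
open import Data.Fin using (Fin; punchIn)
open import Data.Fin.Properties using (_≟_)
open import Data.Bool using (Bool; true; false; not; _∧_; _∨_)
open import Data.Bool.Properties using (∨-comm)
open import Data.Product using (Σ; ∃; _×_; _,_)
open import Data.Empty using (⊥)
open import Function.Definitions using (Injective)
open import Relation.Nullary using (¬_; yes; no)
open import Relation.Nullary.Decidable using (isYes)
open import Relation.Binary.PropositionalEquality using (_≡_; refl; sym; cong₂)

record Graph (n : ℕ) : Set where
  field
    adj     : Fin n → Fin n → Bool
    adj-sym : ∀ i j → adj i j ≡ adj j i
    adj-irr : ∀ i → adj i i ≡ false
open Graph public

_==_ : ∀ {n} → Fin n → Fin n → Bool
i == j = isYes (i ≟ j)

==-sym : ∀ {n} (i j : Fin n) → (i == j) ≡ (j == i)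
==-sym i j with i ≟ j | j ≟ i
... | yes _ | yes _ = refl
... | no  _ | no  _ = refl
... | yes p | no q with q (sym p)
... | ()
==-sym i j | no q | yes p with q (sym p)
... | ()

==-refl : ∀ {n} (i : Fin n) → (i == i) ≡ true
==-refl i with i ≟ i
... | yes _ = refl
... | no q with q refl
... | ()

mkGraph : ∀ {n} → (Fin n → Fin n → Bool) → Graph n
mkGraph f = record
  { adj     = λ i j → not (i == j) ∧ (f i j ∨ f j i)
  ; adj-sym = λ i j → cong₂ (λ a b → not a ∧ b) (==-sym i j) (∨-comm (f i j) (f j i))
  ; adj-irr = λ i → cong₂ (λ a b → not a ∧ b) (==-refl i) refl
  }

compl : ∀ {n} → Graph n → Graph n
compl G = mkGraph (λ i j → not (adj G i j))

-- induced subgraph on the image of a map f : Fin k → Fin n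
-- (used with f injective)
induce : ∀ {k n} → (Fin k → Fin n) → Graph n → Graph k
induce f G = mkGraph (λ i j → adj G (f i) (f j))

delete : ∀ {n} → Graph (suc n) → Fin (suc n) → Graph n
delete G v = induce (punchIn v) G

-- contraction of the edge uv: the vertex v is removed and u becomes the
-- merged vertex, adjacent to every (remaining) neighbour of u or of v;
-- parallel edges are identified and the loop is discarded.
contract : ∀ {n} → Graph (suc n) → Fin (suc n) → Fin (suc n) → Graph n
contract G u v = mkGraph (λ i j →
  let a = punchIn v i ; b = punchIn v j in
  adj G a b ∨ ((a == u) ∧ adj G v b))

data Walk {n} (G : Graph n) : Fin n → Fin n → Set where
  here : ∀ {i} → Walk G i i
  step : ∀ {i j k} → adj G i j ≡ true → Walk G j k → Walk G i k

Connected : ∀ {n} → Graph n → Set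
Connected G = ∀ i j → Walk G i j

-- 2-connected: at least three vertices, connected, and no cut vertex
-- (for a connected graph, v is a cut vertex iff G - v is disconnected).
TwoConnected : ∀ {n} → Graph n → Set
TwoConnected {zero}  G = ⊥
TwoConnected {suc n} G = 3 ≤ suc n × Connected G × (∀ v → Connected (delete G v))

TwoCograph : ∀ {n} → Graph n → Set
TwoCograph {n} G =
  ¬ (Σ ℕ λ k → Σ (Fin k → Fin n) λ f → Injective _≡_ _≡_ f ×
       TwoConnected (induce f G) × TwoConnected (compl (induce f G)))

data IMStep : ∀ {m k} → Graph m → Graph k → Set where
  del : ∀ {n} (G : Graph (suc n)) (v : Fin (suc n)) → IMStep G (delete G v)
  con : ∀ {n} (G : Graph (suc n)) (u v : Fin (suc n)) →
        adj G u v ≡ true → IMStep G (contract G u v)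

data ProperInducedMinor : ∀ {m k} → Graph m → Graph k → Set where
  one  : ∀ {m k} {G : Graph m} {H : Graph k} → IMStep G H → ProperInducedMinor G H
  more : ∀ {m k l} {G : Graph m} {H : Graph k} {K : Graph l} →
         IMStep G H → ProperInducedMinor H K → ProperInducedMinor G K

{-# OPTIONS --safe #-}
-- Write E for adjacency in G and E′ for adjacency in its complement; both are 2-connected, and the
-- two play symmetric roles.  If G has at least 11 vertices, then minimality forces every vertex
-- cut {v , w} of G to be the neighbourhood of a vertex of degree two: otherwise the complement
-- contains a spanning complete bipartite graph on the remaining vertices, so it stays 2-connected
-- under any operation that leaves v and w enough non-neighbours, and some deletion or contraction
-- keeps G 2-connected as well.  Hence every vertex has a neighbour of degree two in E or in E′.
-- Let x be the number of vertices of degree two in E that are E′-adjacent to a vertex of degree two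
-- in E′, and y the number obtained by exchanging E and E′.  Counting the pairs of these vertices
-- yields n + x y ≤ 3 x + 3 y, while x ≤ 2 y and y ≤ 2 x, whence n ≤ 10.
module Submission where

open import Defs
open import Data.Bool using (Bool; true; false; not; _∧_; _∨_; if_then_else_)
import Data.Bool.Properties as Bool
open import Data.Empty using (⊥; ⊥-elim)
open import Data.Fin using (Fin; zero; suc; punchIn; punchOut)
open import Data.Fin.Properties using
  (_≟_; any?; all?; injective⇒≤; punchInᵢ≢i; punchIn-injective; punchIn-punchOut)
open import Data.List as List using (List; []; _∷_; _++_; length)
import Data.List.Membership.DecPropositional as DecMembership
open import Data.List.Membership.Propositional using (_∈_; _∉_; lose)
open import Data.List.Membership.Propositional.Properties using
  (∈-lookup; ∈-map⁺; ∈-concatMap⁺; ∈-filter⁺; ∈-filter⁻; ∈-allFin; ∈-++⁺ˡ; ∈-++⁺ʳ; ∈-++⁻)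
open import Data.List.Properties using
  (length-tabulate; length-++; length-map; filter-accept; filter-reject)
open import Data.List.Relation.Unary.All as All using (All; []; _∷_)
open import Data.List.Relation.Unary.All.Properties using (¬Any⇒All¬; ++⁻ˡ; ++⁻ʳ)
open import Data.List.Relation.Unary.AllPairs using ([]; _∷_)
open import Data.List.Relation.Unary.Any using (here; there; index)
open import Data.List.Relation.Unary.Any.Properties using (lookup-index)
open import Data.List.Relation.Unary.Unique.Propositional using (Unique)
open import Data.List.Relation.Unary.Unique.Propositional.Properties using (filter⁺; allFin⁺; ++⁺)
open import Data.Nat using (ℕ; zero; suc; _≤_; _<_; _+_; _*_; z≤n; s≤s; s≤s⁻¹; _≤?_)
open import Data.Nat.ListAction using (sum)
open import Data.Nat.Properties using
  (≤-trans; ≤-refl; ≤-reflexive; <⇒≱; ≮⇒≥; n≤1+n; m≤m+n; m≤n⇒m≤1+n; +-mono-≤; +-cancelʳ-≤;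
   +-identityʳ; +-suc)
open import Data.Nat.Solver using (module +-*-Solver)
open import Data.Product using (∃; ∃₂; _×_; _,_; proj₁; proj₂)
open import Data.Sum as Sum using (_⊎_; inj₁; inj₂; [_,_]′)
open import Function using (_∘_; id; flip)
open import Relation.Binary.PropositionalEquality using
  (_≡_; _≢_; refl; sym; trans; cong; cong₂; subst; ≢-sym)
open import Relation.Nullary using (¬_; Dec; yes; no; does; contradiction)
open import Relation.Nullary.Decidable using
  (True; toWitness; dec-true; dec-false; decidable-stable; ¬?; _×-dec_; _⊎-dec_; _→-dec_)

-- The obstacle is a vertex `v` with only two neighbours in the complement: after a deletion it may
-- keep a single one, and then the complement gets a cut vertex for a trivial reason that says
-- nothing about `E`. Cuts containing such a vertex must be excluded before cuts in general. The
-- same exclusion is needed for the almost complete bipartitions that arise from contracting an edge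
-- at a vertex of degree two, which is why `Join` tolerates one missing pair. This is where the size
-- matters: at most ten vertices are unusable, so an eleventh gives the contradiction. In the final
-- count, each of the x vertices of the first kind has two places for `E`-neighbours, and each of
-- the y vertices of the second kind has two places for `E′`-neighbours. Each of the x y mixed pairs
-- is an edge of one of the two graphs and uses up one such place, so at most 2 x + 2 y - x y places
-- remain to reach the vertices of neither kind.

covering⇒≤ : ∀ {n} (xs : List (Fin n)) → (∀ x → x ∈ xs) → n ≤ length xs
covering⇒≤ xs cover = injective⇒≤ {f = λ x → index (cover x)} λ {i} {j} eq →
  trans (lookup-index (cover i)) (trans (cong (List.lookup xs) eq) (sym (lookup-index (cover j))))

fresh : ∀ {n} (xs : List (Fin n)) → length xs < n → ∃ λ x → All (x ≢_) xs
fresh {n} xs short with any? (λ x → ¬? (DecMembership._∈?_ _≟_ x xs))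
... | yes (x , x∉xs) = x , ¬Any⇒All¬ xs x∉xs
... | no none = contradiction
  (covering⇒≤ xs λ x → decidable-stable (DecMembership._∈?_ _≟_ x xs) (λ x∉ → none (x , x∉)))
  (<⇒≱ short)

≡⊎≡⇒≡ : ∀ {a b c : Bool} → a ≢ b → c ≢ b → a ≡ c
≡⊎≡⇒≡ {a} {b} {c} p q = trans (Bool.¬-not p) (sym (Bool.¬-not q))

≡not⇒≢ : ∀ {a b : Bool} → a ≡ not b → a ≢ b
≡not⇒≢ eq refl = Bool.not-¬ refl eq

-- Cuts, vertices of degree two, and joins

Off : ∀ {n} → Fin n → Fin n → Fin n → Set
Off a b i = i ≢ a × i ≢ b

-- The labelling `side` exhibits {a , b} as a vertex cut; for a ≡ b it exhibits a cut vertex.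
record Separation {n} (E : Fin n → Fin n → Set) (a b : Fin n) : Set where
  field
    side     : Fin n → Bool
    wit      : Bool → Fin n
    wit-off  : ∀ β → Off a b (wit β)
    wit-side : ∀ β → side (wit β) ≡ β
    mono     : ∀ {i j} → Off a b i → Off a b j → E i j → side i ≡ side j

  cross : ∀ {i j} → Off a b i → Off a b j → side i ≢ side j → ¬ E i j
  cross oi oj ne e = ne (mono oi oj e)

swapSep : ∀ {n} {E : Fin n → Fin n → Set} {a b} → Separation E a b → Separation E b a
swapSep S = record
  { side = side ; wit = wit ; wit-off = λ β → proj₂ (wit-off β) , proj₁ (wit-off β)
  ; wit-side = wit-side
  ; mono = λ { (p , q) (r , s) → mono (q , p) (s , r) } }
  where open Separation S

-- When F is the complement of E, this says that c is a cut vertex of the complement of the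
-- graph obtained from E by contracting uv onto u.
record ContractionCut {n} (F : Fin n → Fin n → Set) (u v c : Fin n) : Set where
  field
    side     : Fin n → Bool
    wit      : Bool → Fin n
    wit-off  : ∀ β → Off v c (wit β)
    wit-side : ∀ β → side (wit β) ≡ β
    mono     : ∀ {i j} → Off v c i → Off v c j → F i j →
               (i ≡ u → F v j) → (j ≡ u → F v i) → side i ≡ side j

record Deg2 {n} (E : Fin n → Fin n → Set) (v a b : Fin n) : Set where
  field
    a≢b  : a ≢ b
    va   : E v a
    vb   : E v b
    only : ∀ {x} → E v x → x ≡ a ⊎ x ≡ b

flipDeg2 : ∀ {n} {E : Fin n → Fin n → Set} {v a b} → Deg2 E v a b → Deg2 E v b a
flipDeg2 d = record { a≢b = ≢-sym a≢b ; va = vb ; vb = va ; only = Sum.swap ∘ only }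
  where open Deg2 d

otherNbr : ∀ {n} {E : Fin n → Fin n → Set} {v a b x} → Deg2 E v a b → E v x →
           ∃ λ σ → E v σ × σ ≢ x × (∀ {y} → E v y → y ≢ x → y ≡ σ)
otherNbr {a = a} {b} d e with Deg2.only d e
... | inj₁ refl = b , Deg2.vb d , ≢-sym (Deg2.a≢b d) ,
  λ f ne → [ (λ eq → contradiction eq ne) , id ]′ (Deg2.only d f)
... | inj₂ refl = a , Deg2.va d , Deg2.a≢b d ,
  λ f ne → [ id , (λ eq → contradiction eq ne) ]′ (Deg2.only d f)

rebase : ∀ {n} {E : Fin n → Fin n → Set} {v a b i j} → Deg2 E v a b → E v i → E v j → i ≢ j →
         ∀ {x} → E v x → x ≡ i ⊎ x ≡ j
rebase {i = i} {j} d ei ej i≢j {x} ex with x ≟ i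
... | yes eq = inj₁ eq
... | no x≢i = let _ , _ , _ , only = otherNbr d ei in
  inj₂ (trans (only ex x≢i) (sym (only ej (≢-sym i≢j))))

-- The set {v , w} together with a bipartition of the remaining vertices that is complete in E,
-- except possibly for the pair of the two neighbours of a vertex v of degree two.
record Join {n} (E : Fin n → Fin n → Set) (v w : Fin n) : Set where
  field
    v≢w   : v ≢ w
    part  : Fin n → Bool

  In : Bool → Fin n → Set
  In β i = Off v w i × part i ≡ β

  field
    two   : ∀ β → ∃₂ λ a b → a ≢ b × In β a × In β b
    cross : ∀ {i j} → Off v w i → Off v w j → part i ≢ part j → E i j ⊎ Deg2 E v i j

  -- Two survivors in each part, so that one more vertex can still be lost.
  Free : Fin n → Set
  Free ρ = ∀ β → ∃₂ λ a b → a ≢ b × (In β a × a ≢ ρ) × (In β b × b ≢ ρ)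

  avoid : ∀ {ρ} → Free ρ → ∀ β x → ∃ λ a → In β a × a ≢ ρ × a ≢ x
  avoid free β x with free β
  ... | a , b , a≢b , (ia , aρ) , (ib , bρ) with a ≟ x
  ...   | no a≢x = a , ia , aρ , a≢x
  ...   | yes refl = b , ib , bρ , ≢-sym a≢b

  module _ {ρ c : Fin n} (free : Free ρ) (m : Fin n → Bool) where
    Reg : Fin n → Set
    Reg i = Off v w i × i ≢ ρ × i ≢ c

    -- What is left of the two parts without `ρ` and `c` is connected, so a labelling that respects
    -- its edges is constant. Only the missing pair needs care. If `v` survives, it links its two
    -- neighbours. If `c` is `v`, the parts lose nothing but `ρ`, so each has a second vertex and a
    -- path of three edges goes around the pair.
    join-connected :
      (∀ {i j} → Reg i → Reg j → part i ≢ part j → E i j → m i ≡ m j) →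
      (v ≢ c → ∀ {i j} → Reg i → Reg j → Deg2 E v i j → m i ≡ m j) →
      ∀ {i j} → Reg i → Reg j → m i ≡ m j
    join-connected h₁ h₂ {i} {j} = conn
      where
      crossing : ∀ {i j} → Reg i → Reg j → part i ≢ part j → m i ≡ m j
      crossing {i} {j} ri@(oi , iρ , _) rj@(oj , jρ , _) ne with cross oi oj ne
      ... | inj₁ e = h₁ ri rj ne e
      ... | inj₂ d with v ≟ c
      ...   | no v≢c = h₂ v≢c ri rj d
      ...   | yes refl with avoid free (part i) i | avoid free (part j) j
      ...     | i₁ , (oi₁ , pi₁) , i₁ρ , i₁≢i | j₁ , (oj₁ , pj₁) , j₁ρ , j₁≢j =
        trans (h₁ ri rj₁ (λ eq → ne (trans eq pj₁)) ij₁)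
          (trans (sym (h₁ ri₁ rj₁ ne₁ i₁j₁))
            (h₁ ri₁ rj (λ eq → ne (trans (sym pi₁) eq)) i₁j))
        where
        ri₁ : Reg i₁
        ri₁ = oi₁ , i₁ρ , proj₁ oi₁
        rj₁ : Reg j₁
        rj₁ = oj₁ , j₁ρ , proj₁ oj₁
        ne₁ : part i₁ ≢ part j₁
        ne₁ eq = ne (trans (sym pi₁) (trans eq pj₁))
        not-i₁ : ¬ E v i₁
        not-i₁ e with Deg2.only d e
        ... | inj₁ eq = i₁≢i eq
        ... | inj₂ refl = ne (sym pi₁)
        not-j₁ : ¬ E v j₁
        not-j₁ e with Deg2.only d e
        ... | inj₁ refl = ne pj₁
        ... | inj₂ eq = j₁≢j eq
        ij₁ : E i j₁
        ij₁ = [ id , (λ d′ → contradiction (Deg2.vb d′) not-j₁) ]′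
                (cross oi oj₁ (λ eq → ne (trans eq pj₁)))
        i₁j₁ : E i₁ j₁
        i₁j₁ = [ id , (λ d′ → contradiction (Deg2.vb d′) not-j₁) ]′ (cross oi₁ oj₁ ne₁)
        i₁j : E i₁ j
        i₁j = [ id , (λ d′ → contradiction (Deg2.va d′) not-i₁) ]′
                (cross oi₁ oj (λ eq → ne (trans (sym pi₁) eq)))
      conn : ∀ {i j} → Reg i → Reg j → m i ≡ m j
      conn {i} {j} ri rj with part i Bool.≟ part j
      ... | no ne = crossing ri rj ne
      ... | yes eq with avoid free (not (part i)) c
      ...   | k , (ok , pk) , kρ , kc =
        trans (crossing ri (ok , kρ , kc) (≢-sym (≡not⇒≢ pk)))
          (sym (crossing rj (ok , kρ , kc)
            (≢-sym (≡not⇒≢ (trans pk (cong not eq))))))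

-- The interface between graphs and the combinatorial argument; it is symmetric in `E` and `E′`, so
-- every result serves twice through `swap`. In `contraction` the first alternative stands for a cut
-- at the merged vertex: any other cut vertex of the contraction would already be one of `E`.
record Critical {n} (E E′ : Fin n → Fin n → Set) : Set where
  field
    large  : 11 ≤ n
    irr    : ∀ {i} → ¬ E i i
    irr′   : ∀ {i} → ¬ E′ i i
    symm   : ∀ {i j} → E i j → E j i
    symm′  : ∀ {i j} → E′ i j → E′ j i
    excl   : ∀ {i j} → E i j → E′ i j → ⊥
    total  : ∀ {i j} → i ≢ j → E i j ⊎ E′ i j
    noCut  : ∀ c → ¬ Separation E c c
    noCut′ : ∀ c → ¬ Separation E′ c c
    deletion : ∀ y → ∃ λ z → z ≢ y × (Separation E y z ⊎ Separation E′ y z)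
    contraction : ∀ {u v} → E u v → Separation E u v ⊎ (∃ λ c → c ≢ v × ContractionCut E′ u v c)
    contraction′ : ∀ {u v} → E′ u v → Separation E′ u v ⊎ (∃ λ c → c ≢ v × ContractionCut E u v c)

swap : ∀ {n} {E E′ : Fin n → Fin n → Set} → Critical E E′ → Critical E′ E
swap C = record
  { large = large ; irr = irr′ ; irr′ = irr ; symm = symm′ ; symm′ = symm
  ; excl = flip excl ; total = Sum.swap ∘ total ; noCut = noCut′ ; noCut′ = noCut
  ; deletion = λ y → let z , z≢y , s = deletion y in z , z≢y , Sum.swap s
  ; contraction = contraction′ ; contraction′ = contraction }
  where open Critical C

-- Consequences of having no cut vertex

module Basics {n} {E E′ : Fin n → Fin n → Set} (C : Critical E E′) where
  open Critical C

  pick : (xs : List (Fin n)) → length xs ≤ 10 → ∃ λ x → All (x ≢_) xs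
  pick xs short = fresh xs (≤-trans (s≤s short) large)

  pick! : (xs : List (Fin n)) {_ : True (length xs ≤? 10)} → ∃ λ x → All (x ≢_) xs
  pick! xs {short} = pick xs (toWitness short)

  E? : ∀ i j → Dec (E i j)
  E? i j with i ≟ j
  ... | yes refl = no irr
  ... | no i≢j with total i≢j
  ...   | inj₁ e = yes e
  ...   | inj₂ e′ = no (λ e → excl e e′)

  toE : ∀ {i j} → i ≢ j → ¬ E′ i j → E i j
  toE ne h = [ id , (λ e → contradiction e h) ]′ (total ne)

  toE′ : ∀ {i j} → i ≢ j → ¬ E i j → E′ i j
  toE′ ne h = [ (λ e → contradiction e h) , id ]′ (total ne)

  -- The form in which `noCut` is applied: a set that no edge leaves away from `c` serves as its own
  -- labelling.
  boundary : (P : Fin n → Set) (P? : ∀ x → Dec (P x)) (c i j : Fin n) →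
             P i → i ≢ c → ¬ P j → j ≢ c →
             ¬ (∀ {x y} → x ≢ c → y ≢ c → P x → ¬ P y → ¬ E x y)
  boundary P P? c i j pi ic pj jc closed = noCut c record
    { side = does ∘ P?
    ; wit = λ { true → i ; false → j }
    ; wit-off = λ { true → ic , ic ; false → jc , jc }
    ; wit-side = λ { true → dec-true (P? i) pi ; false → dec-false (P? j) pj }
    ; mono = λ {x} {y} (xc , _) (yc , _) e → same xc yc e }
    where
    same : ∀ {x y} → x ≢ c → y ≢ c → E x y → does (P? x) ≡ does (P? y)
    same {x} {y} xc yc e with P? x | P? y
    ... | yes _ | yes _ = refl
    ... | no _  | no _  = refl
    ... | yes p | no q  = contradiction e (closed xc yc p q)
    ... | no p  | yes q = contradiction (symm e) (closed yc xc q p)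

  -- Without such a neighbour, `z` alone would cut this side off.
  nbrIn : ∀ {y z} (S : Separation E y z) → ∀ β →
          ∃ λ i → Off y z i × Separation.side S i ≡ β × E y i
  nbrIn {y} {z} S β = decidable-stable found? refute
    where
    open Separation S
    P : Fin n → Set
    P x = Off y z x × side x ≡ β
    P? : ∀ x → Dec (P x)
    P? x = (¬? (x ≟ y) ×-dec ¬? (x ≟ z)) ×-dec (side x Bool.≟ β)
    found? : Dec (∃ λ i → Off y z i × side i ≡ β × E y i)
    found? = any? (λ x → (¬? (x ≟ y) ×-dec ¬? (x ≟ z)) ×-dec (side x Bool.≟ β) ×-dec E? y x)
    refute : ¬ ¬ (∃ λ i → Off y z i × side i ≡ β × E y i)
    refute none = boundary P P? z (wit β) (wit (not β))
      (wit-off β , wit-side β) (proj₂ (wit-off β))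
      (λ p → ≡not⇒≢ (wit-side (not β)) (proj₂ p)) (proj₂ (wit-off (not β))) closed
      where
      closed : ∀ {x x′} → x ≢ z → x′ ≢ z → P x → ¬ P x′ → ¬ E x x′
      closed {x} {x′} xz xz′ (ox , sx) ¬p e with x′ ≟ y
      ... | yes refl = none (x , ox , sx , symm e)
      ... | no x′≢y = ¬p ((x′≢y , xz′) , trans (sym (mono ox (x′≢y , xz′) e)) sx)

  nbrAvoiding : ∀ {v c} → v ≢ c → ∃ λ x → x ≢ c × E v x
  nbrAvoiding {v} {c} v≢c = decidable-stable (any? (λ x → ¬? (x ≟ c) ×-dec E? v x)) refute
    where
    refute : ¬ ¬ (∃ λ x → x ≢ c × E v x)
    refute none with pick! (v ∷ c ∷ [])
    ... | j , jv ∷ jc ∷ [] = boundary (_≡ v) (_≟ v) c v j refl v≢c jv jc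
      λ { _ yc refl _ e → none (_ , yc , e) }

  twoNbrs : ∀ v → ∃₂ λ a b → a ≢ b × E v a × E v b
  twoNbrs v with pick! (v ∷ [])
  ... | c , cv ∷ [] with nbrAvoiding {v} (≢-sym cv)
  ...   | a , _ , va with nbrAvoiding {v} {a} (λ { refl → irr va })
  ...     | b , b≢a , vb = a , b , ≢-sym b≢a , va , vb

  within⇒Deg2 : ∀ {v a b} → (∀ {x} → E v x → x ≡ a ⊎ x ≡ b) → Deg2 E v a b
  within⇒Deg2 {v} within with twoNbrs v
  ... | p , q , p≢q , vp , vq with within vp | within vq
  ...   | inj₁ refl | inj₁ refl = contradiction refl p≢q
  ...   | inj₁ refl | inj₂ refl = record { a≢b = p≢q ; va = vp ; vb = vq ; only = within }
  ...   | inj₂ refl | inj₁ refl = record { a≢b = ≢-sym p≢q ; va = vq ; vb = vp ; only = within }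
  ...   | inj₂ refl | inj₂ refl = contradiction refl p≢q

  ThreeNbrs : Fin n → Set
  ThreeNbrs v = ∃ λ a → ∃ λ b → ∃ λ c → (a ≢ b × c ≢ a × c ≢ b) × E v a × E v b × E v c

  degree : ∀ v → (∃₂ λ a b → Deg2 E v a b) ⊎ ThreeNbrs v
  degree v with twoNbrs v
  ... | a , b , a≢b , va , vb with any? (λ x → (¬? (x ≟ a) ×-dec ¬? (x ≟ b)) ×-dec E? v x)
  ...   | yes (c , (ca , cb) , vc) = inj₂ (a , b , c , (a≢b , ca , cb) , va , vb , vc)
  ...   | no none = inj₁ (a , b , record
    { a≢b = a≢b ; va = va ; vb = vb
    ; only = λ {x} vx → decidable-stable ((x ≟ a) ⊎-dec (x ≟ b))
        (λ h → none (x , (h ∘ inj₁ , h ∘ inj₂) , vx)) })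

  three⊈two : ∀ {v p q} → ThreeNbrs v → ¬ (∀ {x} → E v x → x ≡ p ⊎ x ≡ q)
  three⊈two (a , b , c , (a≢b , ca , cb) , va , vb , vc) within with within va | within vb | within vc
  ... | inj₁ refl | inj₁ refl | _ = a≢b refl
  ... | inj₂ refl | inj₂ refl | _ = a≢b refl
  ... | inj₁ refl | inj₂ refl | inj₁ refl = ca refl
  ... | inj₁ refl | inj₂ refl | inj₂ refl = cb refl
  ... | inj₂ refl | inj₁ refl | inj₁ refl = cb refl
  ... | inj₂ refl | inj₁ refl | inj₂ refl = ca refl

-- Operations that preserve 2-connectedness of the complement

data FreeVertices {n} {E : Fin n → Fin n → Set} {v w} (J : Join E v w) : Set where
  allFree   : (∀ {ρ} → Off v w ρ → Join.Free J ρ) → FreeVertices J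
  smallSide : ∀ β x₁ x₂ → x₁ ≢ x₂ → Join.In J β x₁ → Join.In J β x₂ →
              (∀ {i} → Join.In J β i → i ≡ x₁ ⊎ i ≡ x₂) →
              (∀ {ρ} → Off v w ρ → ρ ≢ x₁ → ρ ≢ x₂ → Join.Free J ρ) → FreeVertices J

module Joins {n} {E E′ : Fin n → Fin n → Set} (C : Critical E E′) where
  open Critical C
  open Basics C
  private module Co = Basics (swap C)

  module _ {v w} (J : Join E′ v w) where
    open Join J

    private
      Third : Bool → Fin n → Fin n → Set
      Third β a b = ∃ λ x → (x ≢ a × x ≢ b) × In β x

      third? : ∀ β a b → Dec (Third β a b)
      third? β a b = any? λ x → (¬? (x ≟ a) ×-dec ¬? (x ≟ b)) ×-dec
                                (¬? (x ≟ v) ×-dec ¬? (x ≟ w)) ×-dec (part x Bool.≟ β)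

      onlyTwo : ∀ {β a b} → ¬ Third β a b → ∀ {i} → In β i → i ≡ a ⊎ i ≡ b
      onlyTwo {β} {a} {b} none {i} ii = decidable-stable ((i ≟ a) ⊎-dec (i ≟ b))
        λ h → none (i , (h ∘ inj₁ , h ∘ inj₂) , ii)

      Remain : Bool → Fin n → Set
      Remain β ρ = ∃₂ λ a b → a ≢ b × (In β a × a ≢ ρ) × (In β b × b ≢ ρ)

      remain₃ : ∀ {β a b} → a ≢ b → In β a → In β b → Third β a b → ∀ ρ → Remain β ρ
      remain₃ {a = a} {b} a≢b ia ib (c , (ca , cb) , ic) ρ with a ≟ ρ | b ≟ ρ
      ... | no aρ | no bρ = a , b , a≢b , (ia , aρ) , (ib , bρ)
      ... | no aρ | yes refl = a , c , ≢-sym ca , (ia , aρ) , (ic , cb)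
      ... | yes refl | _ = b , c , ≢-sym cb , (ib , ≢-sym a≢b) , (ic , ca)

      byLabel : ∀ {P : Bool → Set} β → P β → P (not β) → ∀ γ → P γ
      byLabel true  p q true  = p
      byLabel true  p q false = q
      byLabel false p q true  = q
      byLabel false p q false = p

    -- At least nine vertices lie outside `v` and `w`, so the two parts cannot both consist of two
    -- vertices.
    freeVertices : FreeVertices J
    freeVertices with two true | two false
    ... | a , b , a≢b , ia , ib | c , d , c≢d , ic , id′
      with third? true a b | third? false c d
    ... | yes t₁ | yes t₂ =
      allFree λ {ρ} _ → byLabel true (remain₃ a≢b ia ib t₁ ρ) (remain₃ c≢d ic id′ t₂ ρ)
    ... | yes t₁ | no n₂ = smallSide false c d c≢d ic id′ (onlyTwo n₂) λ {ρ} _ ρc ρd →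
      byLabel true (remain₃ a≢b ia ib t₁ ρ)
        (c , d , c≢d , (ic , ≢-sym ρc) , (id′ , ≢-sym ρd))
    ... | no n₁ | yes t₂ = smallSide true a b a≢b ia ib (onlyTwo n₁) λ {ρ} _ ρa ρb →
      byLabel true (a , b , a≢b , (ia , ≢-sym ρa) , (ib , ≢-sym ρb))
        (remain₃ c≢d ic id′ t₂ ρ)
    ... | no n₁ | no n₂ with pick! (v ∷ w ∷ a ∷ b ∷ c ∷ d ∷ [])
    ...   | x , xv ∷ xw ∷ xa ∷ xb ∷ xc ∷ xd ∷ [] with part x in eq
    ...     | true  = ⊥-elim ([ xa , xb ]′ (onlyTwo n₁ ((xv , xw) , eq)))
    ...     | false = ⊥-elim ([ xc , xd ]′ (onlyTwo n₂ ((xv , xw) , eq)))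

    nonfree : ∃ λ F → length F ≤ 2 × (∀ {ρ} → Off v w ρ → All (ρ ≢_) F → Free ρ)
    nonfree with freeVertices
    ... | allFree free = [] , z≤n , λ oρ _ → free oρ
    ... | smallSide _ x₁ x₂ _ _ _ _ free =
      x₁ ∷ x₂ ∷ [] , ≤-refl , λ { oρ (p ∷ q ∷ []) → free oρ p q }

    -- By `join-connected` all vertices off `v` and `w` lie on one side of the cut, so the other
    -- side is a nonempty subset of {v, w}, with its neighbours in the cut. The three alternatives
    -- are the possible subsets.
    separation-join : ∀ {y z} → Off v w y → Free y → Separation E′ y z →
      (∀ {x} → E′ v x → x ≡ y ⊎ x ≡ z) ⊎ (∀ {x} → E′ w x → x ≡ y ⊎ x ≡ z) ⊎
      (∀ {x} → Off v w x → E′ v x ⊎ E′ w x → x ≡ y ⊎ x ≡ z)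
    separation-join {y} {z} (y≢v , y≢w) free S with avoid free true z
    ... | k , (ok , _) , ky , kz = result
      where
      open Separation S
      b = side k
      main : ∀ {i} → Off v w i → Off y z i → side i ≡ b
      main oi (iy , iz) = join-connected free side
        (λ { (_ , p) (_ , q) _ e → mono p q e })
        (λ { vz (_ , p) (_ , q) d → trans (sym (mono (≢-sym y≢v , vz) p (Deg2.va d)))
                                          (mono (≢-sym y≢v , vz) q (Deg2.vb d)) })
        (oi , iy , iz) (ok , ky , kz)
      stable : ∀ {x} → ¬ (Off y z x) → x ≡ y ⊎ x ≡ z
      stable {x} h = decidable-stable ((x ≟ y) ⊎-dec (x ≟ z)) λ g → h (g ∘ inj₁ , g ∘ inj₂)
      alone : ∀ {a o} → a ≢ y → a ≢ z → side a ≢ b → (o ≢ z → side o ≡ b) →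
              (∀ {x} → x ≢ a → x ≢ o → Off v w x) → ∀ {x} → E′ a x → x ≡ y ⊎ x ≡ z
      alone {a} {o} ay az ab h off {x} e = stable λ ox → ab (trans (mono (ay , az) ox e) (label ox))
        where
        label : Off y z x → side x ≡ b
        label ox with x ≟ o
        ... | yes refl = h (proj₂ ox)
        ... | no xo = main (off (λ { refl → irr′ e }) xo) ox
      neither : v ≢ z → side v ≢ b → w ≢ z → side w ≢ b →
                ∀ {x} → Off v w x → E′ v x ⊎ E′ w x → x ≡ y ⊎ x ≡ z
      neither vz vb wz wb ox (inj₁ e) = stable λ o →
        vb (trans (mono (≢-sym y≢v , vz) o e) (main ox o))
      neither vz vb wz wb ox (inj₂ e) = stable λ o →
        wb (trans (mono (≢-sym y≢w , wz) o e) (main ox o))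
      bad : ∀ {i} → Off y z i → side i ≢ b → i ≡ v ⊎ i ≡ w
      bad {i} o ib = decidable-stable ((i ≟ v) ⊎-dec (i ≟ w)) λ h →
        ib (main (h ∘ inj₁ , h ∘ inj₂) o)
      both : ∀ a → Dec (a ≢ z × side a ≢ b)
      both a = ¬? (a ≟ z) ×-dec ¬? (side a Bool.≟ b)
      rest : ∀ {a} → ¬ (a ≢ z × side a ≢ b) → a ≢ z → side a ≡ b
      rest {a} h az = decidable-stable (side a Bool.≟ b) λ ab → h (az , ab)
      result : (∀ {x} → E′ v x → x ≡ y ⊎ x ≡ z) ⊎ (∀ {x} → E′ w x → x ≡ y ⊎ x ≡ z) ⊎
               (∀ {x} → Off v w x → E′ v x ⊎ E′ w x → x ≡ y ⊎ x ≡ z)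
      result with both v | both w
      ... | yes (vz , vb) | yes (wz , wb) = inj₂ (inj₂ (neither vz vb wz wb))
      ... | yes (vz , vb) | no h = inj₁ (alone (≢-sym y≢v) vz vb (rest h) _,_)
      ... | no h | yes (wz , wb) = inj₂ (inj₁ (alone (≢-sym y≢w) wz wb (rest h) (λ p q → q , p)))
      ... | no h | no h′ with bad (wit-off (not b)) (≡not⇒≢ (wit-side (not b)))
      ...   | inj₁ eq = contradiction
        (subst (λ i → i ≢ z × side i ≢ b) eq
          (proj₂ (wit-off (not b)) , ≡not⇒≢ (wit-side (not b)))) h
      ...   | inj₂ eq = contradiction
        (subst (λ i → i ≢ z × side i ≢ b) eq
          (proj₂ (wit-off (not b)) , ≡not⇒≢ (wit-side (not b)))) h′

  -- Some nonempty S ⊆ {t , s} has its neighbours outside S among y and z, and y is one of them.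
  data Active (t s y z : Fin n) : Set where
    left  : E t y → (∀ {x} → E t x → x ≡ y ⊎ x ≡ z) → Active t s y z
    right : E s y → (∀ {x} → E s x → x ≡ y ⊎ x ≡ z) → Active t s y z
    pair  : E t y ⊎ E s y →
            (∀ x → E t x ⊎ E s x → (x ≡ t ⊎ x ≡ s) ⊎ (x ≡ y ⊎ x ≡ z)) → Active t s y z

  smallSide⇒Active : ∀ {t s y z} (S : Separation E y z) (β : Bool) →
    (∀ {i} → Off y z i → Separation.side S i ≡ β → i ≡ t ⊎ i ≡ s) → Active t s y z
  smallSide⇒Active {t} {s} {y} {z} S β small with nbrIn S β
  ... | i , oi , si , yi = result
    where
    open Separation S
    member? : ∀ a → Dec (Off y z a × side a ≡ β)
    member? a = (¬? (a ≟ y) ×-dec ¬? (a ≟ z)) ×-dec (side a Bool.≟ β)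
    closed : ∀ {a x} → Off y z a × side a ≡ β → E a x → (x ≡ t ⊎ x ≡ s) × (Off y z x × side x ≡ β) ⊎ (x ≡ y ⊎ x ≡ z)
    closed {a} {x} (oa , sa) e with x ≟ y | x ≟ z
    ... | yes p | _ = inj₂ (inj₁ p)
    ... | no _ | yes p = inj₂ (inj₂ p)
    ... | no p | no q = inj₁ (small (p , q) sx , (p , q) , sx)
      where sx = trans (sym (mono oa (p , q) e)) sa
    result : Active t s y z
    result with member? t | member? s
    ... | yes p | yes q = pair
      ([ (λ { refl → inj₁ (symm yi) }) , (λ { refl → inj₂ (symm yi) }) ]′ (small oi si))
      λ x → [ Sum.map₁ proj₁ ∘ closed p , Sum.map₁ proj₁ ∘ closed q ]′
    ... | yes p | no q = left
      ([ (λ { refl → symm yi }) , (λ { refl → contradiction (oi , si) q }) ]′ (small oi si))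
      λ e → [ (λ { (inj₁ refl , _) → contradiction e irr ; (inj₂ refl , m) → contradiction m q }) , id ]′
              (closed p e)
    ... | no p | yes q = right
      ([ (λ { refl → contradiction (oi , si) p }) , (λ { refl → symm yi }) ]′ (small oi si))
      λ e → [ (λ { (inj₁ refl , m) → contradiction m p ; (inj₂ refl , _) → contradiction e irr }) , id ]′
              (closed q e)
    ... | no p | no q = ⊥-elim
      ([ (λ { refl → p (oi , si) }) , (λ { refl → q (oi , si) }) ]′ (small oi si))

  -- For `y` off the list, no cut {y, z} of `E` has a side inside {t, s}. `exact` is a trade-off for
  -- counting: either at most two vertices are listed, which leaves room for three usable ones, or
  -- the usable vertices see neither `t` nor `s`, and then one suffices.
  record ActiveList (t s : Fin n) : Set where
    field
      list     : List (Fin n)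
      short    : length list ≤ 4
      complete : ∀ {y z} → y ≢ t → y ≢ s → All (y ≢_) list → ¬ Active t s y z
      exact    : (∀ {y} → y ≢ t → y ≢ s → All (y ≢_) list → ¬ E t y × ¬ E s y) ⊎ length list ≤ 2

  -- If two vertices y₀ and z₀ account for all neighbours of {t, s} outside this pair, they are the
  -- only candidates. Otherwise `pair` never occurs, and each of the other constructors forces `t`
  -- or `s` to have degree two with `y` among its neighbours.
  activeList : ∀ t s → ActiveList t s
  activeList t s with any? (λ y → any? (λ z → all? (λ x → (E? t x ⊎-dec E? s x) →-dec
                          ((x ≟ t ⊎-dec x ≟ s) ⊎-dec (x ≟ y ⊎-dec x ≟ z)))))
  ... | yes (y₀ , z₀ , within) = record
    { list = y₀ ∷ z₀ ∷ [] ; short = s≤s (s≤s z≤n)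
    ; complete = λ { yt ys a (left e _) → proj₁ (away yt ys a) e
                   ; yt ys a (right e _) → proj₂ (away yt ys a) e
                   ; yt ys a (pair (inj₁ e) _) → proj₁ (away yt ys a) e
                   ; yt ys a (pair (inj₂ e) _) → proj₂ (away yt ys a) e }
    ; exact = inj₁ away }
    where
    away : ∀ {y} → y ≢ t → y ≢ s → All (y ≢_) (y₀ ∷ z₀ ∷ []) → ¬ E t y × ¬ E s y
    away {y} yt ys (p ∷ q ∷ []) = no′ ∘ inj₁ , no′ ∘ inj₂
      where
      no′ : ¬ (E t y ⊎ E s y)
      no′ e = [ [ yt , ys ]′ , [ p , q ]′ ]′ (within y e)
  ... | no none with degree t | degree s
  ...   | inj₁ (a , b , d) | inj₁ (a′ , b′ , d′) = record
    { list = a ∷ b ∷ a′ ∷ b′ ∷ [] ; short = ≤-refl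
    ; complete = λ { _ _ (p ∷ q ∷ _) (left e _) → [ p , q ]′ (Deg2.only d e)
                   ; _ _ (_ ∷ _ ∷ p ∷ q ∷ []) (right e _) → [ p , q ]′ (Deg2.only d′ e)
                   ; {y} {z} _ _ _ (pair _ h) → none (y , z , h) }
    ; exact = inj₁ λ { _ _ (p ∷ q ∷ p′ ∷ q′ ∷ []) →
        (λ e → [ p , q ]′ (Deg2.only d e)) , (λ e → [ p′ , q′ ]′ (Deg2.only d′ e)) } }
  ...   | inj₁ (a , b , d) | inj₂ three = record
    { list = a ∷ b ∷ [] ; short = s≤s (s≤s z≤n)
    ; complete = λ { _ _ (p ∷ q ∷ _) (left e _) → [ p , q ]′ (Deg2.only d e)
                   ; _ _ _ (right _ h) → three⊈two three h
                   ; {y} {z} _ _ _ (pair _ h) → none (y , z , h) }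
    ; exact = inj₂ ≤-refl }
  ...   | inj₂ three | inj₁ (a′ , b′ , d′) = record
    { list = a′ ∷ b′ ∷ [] ; short = s≤s (s≤s z≤n)
    ; complete = λ { _ _ _ (left _ h) → three⊈two three h
                   ; _ _ (p ∷ q ∷ []) (right e _) → [ p , q ]′ (Deg2.only d′ e)
                   ; {y} {z} _ _ _ (pair _ h) → none (y , z , h) }
    ; exact = inj₂ ≤-refl }
  ...   | inj₂ three | inj₂ three′ = record
    { list = [] ; short = z≤n
    ; complete = λ { _ _ _ (left _ h) → three⊈two three h
                   ; _ _ _ (right _ h) → three⊈two three′ h
                   ; {y} {z} _ _ _ (pair _ h) → none (y , z , h) }
    ; exact = inj₂ z≤n }

  -- Some side contains neither `v` nor `w`. It sends no `E`-edge to them, hence only `E′`-edges;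
  -- the one that equals `z` lies in the cut and is exempt.
  awaySide : ∀ {v w y z} → v ≢ w → Off v w y → (S : Separation E y z) →
    (v ≢ z → w ≢ z → Separation.side S v ≡ Separation.side S w) →
    ∃ λ β → ∀ {i} → Off y z i → Separation.side S i ≡ β →
      Off v w i × (v ≢ z → E′ v i) × (w ≢ z → E′ w i)
  awaySide {v} {w} {y} {z} v≢w (yv , yw) S agree = choose
    where
    open Separation S
    away : ∀ {a β i} → a ≢ y → (a ≢ z → side a ≢ β) → Off y z i → side i ≡ β →
           i ≢ a × (a ≢ z → E′ a i)
    away ay h oi si = (λ { refl → h (proj₂ oi) si }) ,
      λ az → toE′ (λ { refl → h az si }) λ e → h az (trans (mono (ay , az) oi e) si)
    choose : ∃ λ β → ∀ {i} → Off y z i → side i ≡ β →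
             Off v w i × (v ≢ z → E′ v i) × (w ≢ z → E′ w i)
    choose with v ≟ z
    ... | no vz = not (side v) , λ oi si →
      let p , q = away (≢-sym yv) (λ _ → ≢-sym (≡not⇒≢ refl)) oi si
          p′ , q′ = away (≢-sym yw) (λ wz eq → ≢-sym (≡not⇒≢ refl) (trans (agree vz wz) eq)) oi si
      in (p , p′) , (λ _ → q vz) , q′
    ... | yes refl = not (side w) , λ oi si →
      let p′ , q′ = away (≢-sym yw) (λ _ → ≢-sym (≡not⇒≢ refl)) oi si
      in (proj₂ oi , p′) , (λ vz → contradiction refl vz) , q′

  module _ {v w} (J : Join E′ v w) where
    open Join J

    -- A vertex `y` away from all exceptions is `E`-adjacent to `v` and `w`. If it lay in a cut {y,
    -- z} of `E′`, then `z` alone would separate `v` or `w` from `y` in `E′`, or `y` would be an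
    -- `E′`-neighbour of one of them. If {y, z} is a cut of `E`, a further common neighbour keeps
    -- `v` and `w` on one side; the other side then consists of `E′`-neighbours, lies inside {t, s}
    -- and makes `y` active.
    few-coneighbours-impossible : ∀ t s →
      ¬ (∀ {x} → Off v w x → E′ v x ⊎ E′ w x → x ≡ t ⊎ x ≡ s)
    few-coneighbours-impossible t s within with nonfree J
    ... | F , shortF , free = refute
      where
      open ActiveList (activeList t s)
      refute : ⊥
      -- Four named vertices, at most two that are not free and at most four on the list: ten in
      -- all.
      refute with pick (v ∷ w ∷ t ∷ s ∷ F ++ list) (s≤s (s≤s (s≤s (s≤s
                    (≤-trans (≤-reflexive (length-++ F)) (+-mono-≤ shortF short))))))
      ... | y , yv ∷ yw ∷ yt ∷ ys ∷ far = body (deletion y)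
        where
        adj-both : ∀ {x} → Off v w x → x ≢ t → x ≢ s → E v x × E w x
        adj-both ox xt xs =
          toE (≢-sym (proj₁ ox)) (λ e → [ xt , xs ]′ (within ox (inj₁ e))) ,
          toE (≢-sym (proj₂ ox)) (λ e → [ xt , xs ]′ (within ox (inj₂ e)))
        vy = proj₁ (adj-both (yv , yw) yt ys)
        wy = proj₂ (adj-both (yv , yw) yt ys)
        single : ∀ {a z} → E a y → ¬ (∀ {x} → E′ a x → x ≡ y ⊎ x ≡ z)
        single {a} ay h with Co.within⇒Deg2 h
        ... | d = excl ay (Deg2.va d)
        body : (∃ λ z → z ≢ y × (Separation E y z ⊎ Separation E′ y z)) → ⊥
        body (z , z≢y , inj₂ S) with separation-join J (yv , yw) (free (yv , yw) (++⁻ˡ F far)) S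
        ... | inj₁ h = single vy h
        ... | inj₂ (inj₁ h) = single wy h
        ... | inj₂ (inj₂ h) = hang
          where
          P? : ∀ x → Dec (x ≡ v ⊎ x ≡ w)
          P? x = x ≟ v ⊎-dec x ≟ w
          ¬Py : ¬ (y ≡ v ⊎ y ≡ w)
          ¬Py = [ yv , yw ]′
          closed : ∀ {x x′} → x ≢ z → x′ ≢ z → x ≡ v ⊎ x ≡ w → ¬ (x′ ≡ v ⊎ x′ ≡ w) → ¬ E′ x x′
          closed {x} {x′} _ x′z px ¬px′ e =
            [ (λ { refl → [ (λ { refl → excl vy e }) , (λ { refl → excl wy e }) ]′ px }) , x′z ]′ got
            where
            e″ : E′ v x′ ⊎ E′ w x′
            e″ = [ (λ { refl → inj₁ e }) , (λ { refl → inj₂ e }) ]′ px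
            got : x′ ≡ y ⊎ x′ ≡ z
            got = h (¬px′ ∘ inj₁ , ¬px′ ∘ inj₂) e″
          hang : ⊥
          hang with v ≟ z
          ... | no vz = Co.boundary _ P? z v y (inj₁ refl) vz ¬Py (≢-sym z≢y) closed
          ... | yes refl = Co.boundary _ P? z w y (inj₂ refl) (≢-sym v≢w) ¬Py (≢-sym z≢y) closed
        body (z , z≢y , inj₁ S) with pick! (v ∷ w ∷ t ∷ s ∷ y ∷ z ∷ [])
        ... | u , uv ∷ uw ∷ ut ∷ us ∷ uy ∷ uz ∷ [] =
          complete yt ys (++⁻ʳ F far) (smallSide⇒Active S (proj₁ away) small)
          where
          open Separation S
          away = awaySide v≢w (yv , yw) S λ vz wz →
            trans (mono (≢-sym yv , vz) (uy , uz) (proj₁ (adj-both (uv , uw) ut us)))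
                  (sym (mono (≢-sym yw , wz) (uy , uz) (proj₂ (adj-both (uv , uw) ut us))))
          small : ∀ {i} → Off y z i → side i ≡ proj₁ away → i ≡ t ⊎ i ≡ s
          small oi si with proj₂ away oi si | v ≟ z
          ... | ov , pv , pw | no vz = within ov (inj₁ (pv vz))
          ... | ov , pv , pw | yes refl = within ov (inj₂ (pw (≢-sym v≢w)))

-- Vertex cuts containing a vertex with only two non-neighbours

module TightLoose {n} {E E′ : Fin n → Fin n → Set} (C : Critical E E′)
                  {v w t s} (J : Join E′ v w) (D : Deg2 E′ v t s)
                  (three : Basics.ThreeNbrs (swap C) w) where
  open Critical C
  open Basics C
  open Joins C
  open Join J
  private module Co = Basics (swap C)

  Off₄ : Fin n → Set
  Off₄ y = Off v w y × y ≢ t × y ≢ s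

  coedge-avoids : ∀ {y} → Off₄ y → ¬ E′ v y
  coedge-avoids (_ , yt , ys) = [ yt , ys ]′ ∘ Deg2.only D

  -- Vertices opposite to `u` are `E′`-adjacent to both `u` and `y`, so the contraction costs the
  -- join no more than the vertex `y`. The neighbours `t` and `s` of `v` differ from `u` and `y`.
  -- The delicate vertex is `w`, which may lose neighbours when `u` and `y` merge.
  contraction-join : ∀ {u y c} → Off₄ u → Off₄ y → Free y → c ≢ y → E u y →
                     ¬ ContractionCut E′ u y c
  contraction-join {u} {y} {c} u₄@(ou@(uv , uw) , ut , us) y₄@(oy@(yv , yw) , yt , ys) free c≢y uy S
    with avoid free true c
  ... | k , (ok , _) , ky , kc = absurd
    where
    open ContractionCut S
    b = side k
    same-part : part u ≡ part y
    same-part = decidable-stable (part u Bool.≟ part y) λ ne →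
      [ excl uy , (λ d → coedge-avoids u₄ (Deg2.va d)) ]′ (cross ou oy ne)
    across : ∀ {j} → Off v w j → part u ≢ part j → E′ y j
    across oj ne = [ id , (λ d → contradiction (Deg2.va d) (coedge-avoids y₄)) ]′
      (cross oy oj (λ eq → ne (trans same-part eq)))
    v-mono : ∀ {x} → v ≢ c → Off y c x → E′ v x → side v ≡ side x
    v-mono vc ox e = mono (≢-sym yv , vc) ox e (λ { refl → contradiction refl uv })
      λ { refl → contradiction e (coedge-avoids u₄) }
    main : ∀ {i} → Off v w i → Off y c i → side i ≡ b
    main oi (iy , ic) = join-connected free side
      (λ { (oi , iy , ic) (oj , jy , jc) ne e → mono (iy , ic) (jy , jc) e
             (λ { refl → across oj ne }) (λ { refl → across oi (≢-sym ne) }) })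
      (λ { vc (_ , oi) (_ , oj) d → trans (sym (v-mono vc oi (Deg2.va d))) (v-mono vc oj (Deg2.vb d)) })
      (oi , iy , ic) (ok , ky , kc)
    t-off : t ≢ c → Off y c t
    t-off tc = ≢-sym yt , tc
    s-off : s ≢ c → Off y c s
    s-off sc = ≢-sym ys , sc
    w-main : w ≢ c → side w ≡ b
    w-main wc = decidable-stable (side w Bool.≟ b) refute
      where
      refute : side w ≢ b → ⊥
      refute wb = bounded
        where
        escape : ∀ {x} → E′ w x → x ≢ v → x ≢ c → x ≢ y → (x ≡ u → E′ y w) → ⊥
        escape {x} e xv xc xy h = wb (trans
          (mono (≢-sym yw , wc) (xy , xc) e (λ { refl → contradiction refl uw }) h)
          (main (xv , λ { refl → irr′ e }) (xy , xc)))
        -- If `y` is an `E′`-neighbour of `w`, an edge from `w` to `u` survives the merger. If not,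
        -- `u` is the only neighbour that merging can take away. So one exception κ besides `c` is
        -- enough.
        κ-bound : ∃ λ κ → ∀ {x} → E′ w x → x ≢ v → x ≡ c ⊎ x ≡ κ
        κ-bound with Co.E? y w
        ... | yes yw′ = y , λ {x} e xv → decidable-stable (x ≟ c ⊎-dec x ≟ y) λ h →
          escape e xv (h ∘ inj₁) (h ∘ inj₂) λ _ → yw′
        ... | no ¬yw = u , λ {x} e xv → decidable-stable (x ≟ c ⊎-dec x ≟ u) λ h →
          escape e xv (h ∘ inj₁) (λ { refl → ¬yw (symm′ e) }) (λ eq → contradiction (inj₂ eq) h)
        bounded : ⊥
        bounded with κ-bound | Co.E? v w
        ... | κ , κ-within | no ¬vw =
          Co.three⊈two three λ e → κ-within e λ { refl → ¬vw (symm′ e) }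
        -- Now `w` reaches the rest through `v` and the other neighbour σ of `v`, unless `c` blocks
        -- this path; a blocked path leaves too few `E′`-neighbours for `v` and `w` together.
        ... | κ , κ-within | yes vw with otherNbr D vw
        ...   | σ , vσ , σw , σ-only with v ≟ c | σ ≟ c
        ...     | no vc | no σc = wb (trans
          (mono (≢-sym yw , wc) (≢-sym yv , vc) (symm′ vw)
            (λ { refl → contradiction refl uw }) (λ { refl → contradiction refl uv }))
          (trans (v-mono vc (σy , σc) vσ) (main ((λ { refl → irr′ vσ }) , σw) (σy , σc))))
          where
          σy : σ ≢ y
          σy refl = coedge-avoids y₄ vσ
        ...     | yes refl | _ = few-coneighbours-impossible J σ κ λ
          { (_ , xw) (inj₁ e) → inj₁ (σ-only e xw)
          ; (xv , _) (inj₂ e) → inj₂ ([ (λ eq → contradiction eq xv) , id ]′ (κ-within e xv)) }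
        ...     | no _ | yes refl = few-coneighbours-impossible J σ κ λ
          { (_ , xw) (inj₁ e) → inj₁ (σ-only e xw)
          ; (xv , _) (inj₂ e) → κ-within e xv }
    v-main : v ≢ c → side v ≡ b
    v-main vc with t ≟ w | s ≟ w
    ... | no tw | no sw with t ≟ c
    ...   | no tc = trans (v-mono vc (t-off tc) (Deg2.va D))
                      (main ((λ { refl → irr′ (Deg2.va D) }) , tw) (t-off tc))
    ...   | yes refl = trans (v-mono vc (s-off sc) (Deg2.vb D))
                      (main ((λ { refl → irr′ (Deg2.vb D) }) , sw) (s-off sc))
      where sc = ≢-sym (Deg2.a≢b D)
    v-main vc | yes refl | _ with w ≟ c
    ...   | no wc = trans (v-mono vc (t-off wc) (Deg2.va D)) (w-main wc)
    ...   | yes refl = trans (v-mono vc (s-off sc) (Deg2.vb D))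
                      (main ((λ { refl → irr′ (Deg2.vb D) }) , sc) (s-off sc))
      where sc = ≢-sym (Deg2.a≢b D)
    v-main vc | no tw | yes refl with w ≟ c
    ...   | no wc = trans (v-mono vc (s-off wc) (Deg2.vb D)) (w-main wc)
    ...   | yes refl = trans (v-mono vc (t-off (Deg2.a≢b D)) (Deg2.va D))
                      (main ((λ { refl → irr′ (Deg2.va D) }) , tw) (t-off (Deg2.a≢b D)))
    absurd : ⊥
    absurd with wit (not b) ≟ v | wit (not b) ≟ w
    ... | yes eq | _ = ≡not⇒≢ (wit-side (not b))
      (trans (cong side eq) (v-main λ { refl → proj₂ (wit-off (not b)) eq }))
    ... | no _ | yes eq = ≡not⇒≢ (wit-side (not b))
      (trans (cong side eq) (w-main λ { refl → proj₂ (wit-off (not b)) eq }))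
    ... | no iv | no iw = ≡not⇒≢ (wit-side (not b)) (main (iv , iw) (wit-off (not b)))

  open ActiveList (activeList t s)

  Good : Fin n → Set
  Good y = Off₄ y × Free y × All (y ≢_) list

  -- Otherwise the side without `v` consists of `E′`-neighbours of `v`, so it lies inside {t, s} and
  -- `y` is active.
  cut-at-v : ∀ {y z} → Good y → Separation E y z → z ≡ v
  cut-at-v {y} {z} (((yv , _) , yt , ys) , _ , y∉) S = decidable-stable (z ≟ v) λ zv →
    complete yt ys y∉ (smallSide⇒Active S (not (side v)) λ {i} oi si →
      Deg2.only D (toE′ (λ { refl → ≡not⇒≢ si refl })
        λ e → ≡not⇒≢ si (sym (mono (≢-sym yv , ≢-sym zv) oi e))))
    where open Separation S

  good⇒cut : ∀ {y} → Good y → Separation E y v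
  good⇒cut {y} g@((oy , yt , ys) , free , _) with deletion y
  ... | z , _ , inj₁ S with cut-at-v g S
  ...   | refl = S
  good⇒cut {y} g@((oy , yt , ys) , free , _) | z , _ , inj₂ S
    with separation-join J oy free S
  ... | inj₁ h = ⊥-elim (Deg2.a≢b D (trans (far yt (Deg2.va D)) (sym (far ys (Deg2.vb D)))))
    where
    far : ∀ {x} → y ≢ x → E′ v x → x ≡ z
    far yx e = [ (λ eq → contradiction (sym eq) yx) , id ]′ (h e)
  ... | inj₂ (inj₁ h) = ⊥-elim (Co.three⊈two three h)
  ... | inj₂ (inj₂ h) = ⊥-elim (few-coneighbours-impossible J y z h)

  Terminal : Fin n → Set
  Terminal x = x ≡ w ⊎ x ≡ t ⊎ x ≡ s

  -- The edge to any other neighbour could be contracted with both graphs staying 2-connected: by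
  -- `cut-at-v` its ends do not form a cut of `E`, and `contraction-join` takes care of the
  -- complement.
  good⇒nbr : ∀ {y x} → Good y → E y x → x ≢ v → Terminal x
  good⇒nbr {y} {x} g@(y₄ , free , _) e xv =
    decidable-stable (x ≟ w ⊎-dec (x ≟ t ⊎-dec x ≟ s)) λ h →
      let x₄ = (xv , h ∘ inj₁) , h ∘ inj₂ ∘ inj₁ , h ∘ inj₂ ∘ inj₂ in
      [ (λ S → xv (cut-at-v g (swapSep S)))
      , (λ { (c , c≢y , S) → contraction-join x₄ y₄ free c≢y (symm e) S }) ]′
      (contraction (symm e))

  terminal-off : ∀ {y x} → Good y → Terminal x → Off y v x
  terminal-off (((_ , yw) , _) , _) (inj₁ refl) = ≢-sym yw , ≢-sym v≢w
  terminal-off ((_ , yt , _) , _) (inj₂ (inj₁ refl)) = ≢-sym yt , λ { refl → irr′ (Deg2.va D) }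
  terminal-off ((_ , _ , ys) , _) (inj₂ (inj₂ refl)) = ≢-sym ys , λ { refl → irr′ (Deg2.vb D) }

  label : ∀ {y} → Good y → Fin n → Bool
  label g = Separation.side (good⇒cut g)

  terminal-nbr : ∀ {y} (g : Good y) β → ∃ λ i → Terminal i × label g i ≡ β × E y i
  terminal-nbr g β with nbrIn (good⇒cut g) β
  ... | i , (_ , iv) , si , e = i , good⇒nbr g e iv , si , e

  unsplit : ∀ {y y′ i j} (g : Good y) → Good y′ → y′ ≢ y →
            Terminal i → Terminal j → E y′ i → E y′ j → label g i ≡ label g j
  unsplit g ((((yv , _) , _)) , _) ne ti tj ei ej =
    trans (sym (mono (ne , yv) (terminal-off g ti) ei)) (mono (ne , yv) (terminal-off g tj) ej)
    where open Separation (good⇒cut g)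

  true≢false : ∀ {a b : Bool} → a ≡ true → b ≡ false → a ≢ b
  true≢false refl refl ()

  module _ {y₁ y₂ y₃} (g₁ : Good y₁) (g₂ : Good y₂) (g₃ : Good y₃)
           (21≢ : y₂ ≢ y₁) (31≢ : y₃ ≢ y₁) (32≢ : y₃ ≢ y₂) where

    -- If the cut of y₁ separates the terminal o from p and q, then y₂ and y₃ both see exactly
    -- p and q, contradicting that the cut of y₂ separates the neighbours of y₂.
    odd-one-out : ∀ {o p q} → (∀ {x} → Terminal x → x ≡ o ⊎ x ≡ p ⊎ x ≡ q) →
      Terminal p → Terminal q → label g₁ o ≢ label g₁ p → label g₁ p ≡ label g₁ q → ⊥
    odd-one-out {o} {p} {q} cover tp tq op pq =
      let e₂p , e₂q , ne = split g₂ 21≢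
          e₃p , e₃q , _ = split g₃ 31≢
      in ne (unsplit g₂ g₃ 32≢ tp tq e₃p e₃q)
      where
      split : ∀ {y} (g : Good y) → y ≢ y₁ → E y p × E y q × label g p ≢ label g q
      split g ne with terminal-nbr g true | terminal-nbr g false
      ... | i , ti , si , ei | j , tj , sj , ej with unsplit g₁ g ne ti tj ei ej
      ...   | eq with cover ti | cover tj
      ... | inj₁ refl | inj₁ refl = ⊥-elim (true≢false si sj refl)
      ... | inj₁ refl | inj₂ (inj₁ refl) = contradiction eq op
      ... | inj₁ refl | inj₂ (inj₂ refl) = contradiction (trans eq (sym pq)) op
      ... | inj₂ (inj₁ refl) | inj₁ refl = contradiction (sym eq) op
      ... | inj₂ (inj₁ refl) | inj₂ (inj₁ refl) = ⊥-elim (true≢false si sj refl)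
      ... | inj₂ (inj₁ refl) | inj₂ (inj₂ refl) = ei , ej , true≢false si sj
      ... | inj₂ (inj₂ refl) | inj₁ refl = contradiction (trans (sym eq) (sym pq)) op
      ... | inj₂ (inj₂ refl) | inj₂ (inj₁ refl) = ej , ei , ≢-sym (true≢false si sj)
      ... | inj₂ (inj₂ refl) | inj₂ (inj₂ refl) = ⊥-elim (true≢false si sj refl)

    -- Both sides of the cut at `y₁` contain a terminal, so the three terminals split into one and
    -- two; the cases differ in the odd one.
    three-good : ⊥
    three-good with label g₁ w Bool.≟ label g₁ t | label g₁ t Bool.≟ label g₁ s
    ... | yes wt | no ts = odd-one-out {s} {t} {w}
      [ inj₂ ∘ inj₂ , [ inj₂ ∘ inj₁ , inj₁ ]′ ]′ (inj₂ (inj₁ refl)) (inj₁ refl) (≢-sym ts) (sym wt)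
    ... | no wt | yes ts = odd-one-out {w} {t} {s} id (inj₂ (inj₁ refl)) (inj₂ (inj₂ refl)) wt ts
    ... | no wt | no ts = odd-one-out {t} {w} {s}
      [ inj₂ ∘ inj₁ , [ inj₁ , inj₂ ∘ inj₂ ]′ ]′ (inj₁ refl) (inj₂ (inj₂ refl)) (≢-sym wt)
      (≡⊎≡⇒≡ wt (≢-sym ts))
    ... | yes wt | yes ts with terminal-nbr g₁ true | terminal-nbr g₁ false
    ...   | _ , ti , si , _ | _ , tj , sj , _ =
      true≢false si sj (trans (all-w ti) (sym (all-w tj)))
      where
      all-w : ∀ {x} → Terminal x → label g₁ x ≡ label g₁ w
      all-w (inj₁ refl) = refl
      all-w (inj₂ (inj₁ refl)) = sym wt
      all-w (inj₂ (inj₂ refl)) = sym (trans wt ts)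

  impossible : ⊥
  impossible with nonfree J
  ... | F , shortF , free = by exact
    where
    good : ∀ {y} → y ≢ v → y ≢ w → y ≢ t → y ≢ s → All (y ≢_) (F ++ list) → Good y
    good yv yw yt ys far =
      ((yv , yw) , yt , ys) , free (yv , yw) (++⁻ˡ F far) , ++⁻ʳ F far
    total-short : ∀ {k} → length list ≤ k → length (F ++ list) ≤ 2 + k
    total-short h = ≤-trans (≤-reflexive (length-++ F)) (+-mono-≤ shortF h)
    by : (∀ {y} → y ≢ t → y ≢ s → All (y ≢_) list → ¬ E t y × ¬ E s y) ⊎ length list ≤ 2 → ⊥
    -- A good vertex that sees neither `t` nor `s` has only `w` as a neighbour besides `v`, yet each
    -- side of its cut needs one.
    by (inj₁ nonadjacent)
      with pick (v ∷ w ∷ t ∷ s ∷ F ++ list) (s≤s (s≤s (s≤s (s≤s (total-short short)))))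
    ... | y , yv ∷ yw ∷ yt ∷ ys ∷ far with good yv yw yt ys far
    ...   | g with terminal-nbr g true | terminal-nbr g false
    ...     | _ , ti , si , ei | _ , tj , sj , ej with only-w ti ei | only-w tj ej
      where
      only-w : ∀ {x} → Terminal x → E y x → x ≡ w
      only-w (inj₁ eq) _ = eq
      only-w (inj₂ (inj₁ refl)) e = contradiction (symm e) (proj₁ (nonadjacent yt ys (++⁻ʳ F far)))
      only-w (inj₂ (inj₂ refl)) e = contradiction (symm e) (proj₂ (nonadjacent yt ys (++⁻ʳ F far)))
    ...       | refl | refl = true≢false si sj refl
    -- The three choices exclude at most eight, nine and ten vertices.
    by (inj₂ short₂)
      with pick (v ∷ w ∷ t ∷ s ∷ F ++ list)
             (≤-trans (s≤s (s≤s (s≤s (s≤s (total-short short₂))))) (m≤m+n 8 2))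
    ... | y₁ , yv₁ ∷ yw₁ ∷ yt₁ ∷ ys₁ ∷ far₁
      with pick (y₁ ∷ v ∷ w ∷ t ∷ s ∷ F ++ list)
             (≤-trans (s≤s (s≤s (s≤s (s≤s (s≤s (total-short short₂)))))) (m≤m+n 9 1))
    ... | y₂ , ne₂₁ ∷ yv₂ ∷ yw₂ ∷ yt₂ ∷ ys₂ ∷ far₂
      with pick (y₁ ∷ y₂ ∷ v ∷ w ∷ t ∷ s ∷ F ++ list)
             (s≤s (s≤s (s≤s (s≤s (s≤s (s≤s (total-short short₂)))))))
    ... | y₃ , ne₃₁ ∷ ne₃₂ ∷ yv₃ ∷ yw₃ ∷ yt₃ ∷ ys₃ ∷ far₃ =
      three-good (good yv₁ yw₁ yt₁ ys₁ far₁) (good yv₂ yw₂ yt₂ ys₂ far₂)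
                 (good yv₃ yw₃ yt₃ ys₃ far₃) ne₂₁ ne₃₁ ne₃₂

-- Joins whose vertices `v` and `w` both have degree two in the complement

record Few {n} (P : Fin n → Set) (k : ℕ) : Set where
  field
    list  : List (Fin n)
    short : length list ≤ k
    all∈  : ∀ {y} → P y → y ∈ list

atMostOne : ∀ {n} {P : Fin n → Set} → (∀ x → Dec (P x)) → (∀ {x y} → P x → P y → x ≡ y) → Few P 1
atMostOne P? unique with any? P?
... | yes (x , px) = record { list = x ∷ [] ; short = ≤-refl ; all∈ = λ py → here (unique py px) }
... | no none = record { list = [] ; short = z≤n ; all∈ = λ py → contradiction (_ , py) none }

module TightTight {n} {E E′ : Fin n → Fin n → Set} (C : Critical E E′) {v w} (J : Join E′ v w)
                  {t₀ s₀ r₀ q₀} (D₀ : Deg2 E′ v t₀ s₀) (D₀′ : Deg2 E′ w r₀ q₀) where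
  open Critical C
  open Basics C
  open Joins C
  open Join J
  private module Co = Basics (swap C)

  -- Otherwise each of `v` and `w` would have just one further `E′`-neighbour, against
  -- `few-coneighbours-impossible`.
  vw : E v w
  vw = toE v≢w λ e → let σ , _ , _ , only = otherNbr D₀ e
                         σ′ , _ , _ , only′ = otherNbr D₀′ (symm′ e) in
    few-coneighbours-impossible J σ σ′ λ
      { (_ , xw) (inj₁ h) → inj₁ (only h xw) ; (xv , _) (inj₂ h) → inj₂ (only′ h xv) }

  common-unique : ∀ {i j} → E′ v i → E′ w i → E′ v j → E′ w j → i ≡ j
  common-unique {i} {j} vi wi vj wj = decidable-stable (i ≟ j) λ i≢j →
    few-coneighbours-impossible J i j λ
      { _ (inj₁ e) → rebase D₀ vi vj i≢j e ; _ (inj₂ e) → rebase D₀′ wi wj i≢j e }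

  -- The trace of an `E`-cut {y, h}: `i` is a neighbour of `y` on the side away from `a`, and this
  -- whole side is `E′`-adjacent to `a`.
  Via : Fin n → Fin n → Fin n → Fin n → Set
  Via a h i y = E i y × (∀ x → E i x → E′ a x ⊎ x ≡ y ⊎ x ≡ h)

  data Attached (y : Fin n) : Set where
    atW    : ∀ i → E′ v i → Via v w i y → Attached y
    atV    : ∀ i → E′ w i → Via w v i y → Attached y
    common : ∀ i z → E′ v i → E′ w i → E i y → (∀ {x} → E i x → x ≡ y ⊎ x ≡ z) → Attached y

  -- The edge `vw` keeps `v` and `w` from lying on opposite sides. The constructors correspond to
  -- `z` being `w`, being `v`, or neither; in the last case the far side consists of common
  -- `E′`-neighbours of `v` and `w`, so by `common-unique` it is a single vertex.
  separation⇒attached : ∀ {y z} → Off v w y → Separation E y z → Attached y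
  separation⇒attached {y} {z} oy@(yv , yw) S
    with awaySide v≢w oy S (λ vz wz → Separation.mono S (≢-sym yv , vz) (≢-sym yw , wz) vw)
  ... | β , away with nbrIn S β
  ...   | i , oi , si , yi with away oi si
  ...     | _ , vi , wi = result
    where
    open Separation S
    stays : ∀ {x} → E i x → (Off y z x × side x ≡ β) ⊎ x ≡ y ⊎ x ≡ z
    stays {x} e with x ≟ y | x ≟ z
    ... | yes p | _ = inj₂ (inj₁ p)
    ... | no _ | yes p = inj₂ (inj₂ p)
    ... | no p | no q = inj₁ ((p , q) , trans (sym (mono oi (p , q) e)) si)
    result : Attached y
    result with z ≟ w | z ≟ v
    ... | yes refl | _ = atW i (vi v≢w) (symm yi ,
      λ x e → Sum.map₁ (λ { (ox , sx) → proj₁ (proj₂ (away ox sx)) v≢w }) (stays e))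
    ... | no _ | yes refl = atV i (wi (≢-sym v≢w)) (symm yi ,
      λ x e → Sum.map₁ (λ { (ox , sx) → proj₂ (proj₂ (away ox sx)) (≢-sym v≢w) }) (stays e))
    ... | no zw | no zv = common i z (vi (≢-sym zv)) (wi (≢-sym zw)) (symm yi) λ e →
      [ (λ { (ox , sx) → contradiction
             (subst (E i) (common-unique (proj₁ (proj₂ (away ox sx)) (≢-sym zv))
                                         (proj₂ (proj₂ (away ox sx)) (≢-sym zw))
                                         (vi (≢-sym zv)) (wi (≢-sym zw))) e) irr }) , id ]′
      (stays e)

  Plain : Fin n → Set
  Plain y = Off v w y × ¬ E′ v y × ¬ E′ w y

  plain? : ∀ y → Dec (Plain y)
  plain? y = (¬? (y ≟ v) ×-dec ¬? (y ≟ w)) ×-dec ¬? (Co.E? v y) ×-dec ¬? (Co.E? w y)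

  plain⇒attached : ∀ {y} → Plain y → Free y → Attached y
  plain⇒attached {y} (oy , ¬vy , ¬wy) free with deletion y
  ... | z , _ , inj₁ S = separation⇒attached oy S
  ... | z , _ , inj₂ S with separation-join J oy free S
  ...   | inj₁ h = contradiction (Deg2.va (Co.within⇒Deg2 h)) ¬vy
  ...   | inj₂ (inj₁ h) = contradiction (Deg2.va (Co.within⇒Deg2 h)) ¬wy
  ...   | inj₂ (inj₂ h) = ⊥-elim (few-coneighbours-impossible J y z h)

  via? : ∀ a h i y → Dec (Via a h i y)
  via? a h i y = E? i y ×-dec all? (λ x → E? i x →-dec (Co.E? a x ⊎-dec (x ≟ y ⊎-dec x ≟ h)))

  -- Among the neighbours that `Via` allows to `i`, only `y` can be plain.
  via-few : ∀ {a h} → (∀ {y} → Plain y → ¬ E′ a y × y ≢ h) → ∀ i → Few (λ y → Plain y × Via a h i y) 1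
  via-few plain i = atMostOne (λ y → plain? y ×-dec via? _ _ i y)
    λ { {x} (px , ix , _) (py , _ , only) →
        [ (λ e → contradiction e (proj₁ (plain px))) , [ id , (λ e → contradiction e (proj₂ (plain px))) ]′ ]′
        (only x ix) }

  viaW-few : ∀ i → Few (λ y → Plain y × Via v w i y) 1
  viaW-few = via-few λ { ((_ , yw) , ¬vy , _) → ¬vy , yw }

  viaV-few : ∀ i → Few (λ y → Plain y × Via w v i y) 1
  viaV-few = via-few λ { ((yv , _) , _ , ¬wy) → ¬wy , yv }

  Pendant : Fin n → Fin n → Set
  Pendant i y = E i y × ∃ λ z → ∀ {x} → E i x → x ≡ y ⊎ x ≡ z

  pendant-few : ∀ i → Few (λ y → Plain y × Pendant i y) 2
  pendant-few i with degree i
  ... | inj₁ (a , b , d) = record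
    { list = a ∷ b ∷ [] ; short = ≤-refl
    ; all∈ = λ { (_ , e , _) → [ here , there ∘ here ]′ (Deg2.only d e) } }
  ... | inj₂ three = record
    { list = [] ; short = z≤n ; all∈ = λ { (_ , _ , _ , h) → ⊥-elim (three⊈two three h) } }

  module _ (F : List (Fin n)) (free : ∀ {ρ} → Off v w ρ → All (ρ ≢_) F → Free ρ)
           (blocked : ∀ {i y} → i ∈ F → Plain y → All (y ≢_) F → ¬ E i y) where

    -- The vertices lost on account of one `E′`-neighbour `i` of `v` or `w`: `i` itself and the
    -- plain vertices attached through it. A member of `F` costs nothing extra, since it is already
    -- excluded and, by `blocked`, attaches nothing.
    record Block (i : Fin n) (P : Fin n → Set) (k : ℕ) : Set where
      field
        list   : List (Fin n)
        short  : length list ≤ suc k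
        empty  : i ∈ F → length list ≤ 0
        avoids : ∀ {y} → All (y ≢_) F → All (y ≢_) list → y ≢ i
        kills  : ∀ {y} → All (y ≢_) F → All (y ≢_) list → Plain y → ¬ P y

    block : ∀ {i P k} → (∀ {y} → P y → E i y) → Few (λ y → Plain y × P y) k → Block i P k
    block {i} adj few with DecMembership._∈?_ _≟_ i F
    ... | yes i∈F = record
      { list = [] ; short = z≤n ; empty = λ _ → z≤n
      ; avoids = λ far _ → All.lookup far i∈F
      ; kills = λ far _ plain p → blocked i∈F plain far (adj p) }
    ... | no i∉F = record
      { list = i ∷ list ; short = s≤s short ; empty = λ i∈F → contradiction i∈F i∉F
      ; avoids = λ { _ (y≢i ∷ _) → y≢i }
      ; kills = λ { _ (_ ∷ far) plain p → All.lookup far (all∈ (plain , p)) refl } }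
      where open Few few

    -- A two-element small part is affordable only if it contains an `E′`-neighbour of `v` or `w`,
    -- whose block is then empty.
    Few-exceptions : Set
    Few-exceptions = length F ≤ 0 ⊎ length F ≤ 2 × ∃ λ i → i ∈ F × (E′ v i ⊎ E′ w i)

    module Disjoint {t s r q} (D : Deg2 E′ v t s) (D′ : Deg2 E′ w r q) where
      module T = Block (block {t} {Via v w t} proj₁ (viaW-few t))
      module S = Block (block {s} {Via v w s} proj₁ (viaW-few s))
      module R = Block (block {r} {Via w v r} proj₁ (viaV-few r))
      module Q = Block (block {q} {Via w v q} proj₁ (viaV-few q))

      -- Four blocks of two vertices, or `F` and three such blocks; together with `v` and `w` this
      -- excludes ten vertices.
      summands : Few-exceptions → length F + (length T.list + (length S.list + (length R.list + length Q.list))) ≤ 8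
      summands few with few
      ... | inj₁ f = +-mono-≤ f (+-mono-≤ T.short (+-mono-≤ S.short (+-mono-≤ R.short Q.short)))
      ... | inj₂ (f , i , i∈F , inj₁ e) with Deg2.only D e
      ...   | inj₁ refl = +-mono-≤ f (+-mono-≤ (T.empty i∈F) (+-mono-≤ S.short (+-mono-≤ R.short Q.short)))
      ...   | inj₂ refl = +-mono-≤ f (+-mono-≤ T.short (+-mono-≤ (S.empty i∈F) (+-mono-≤ R.short Q.short)))
      summands few | inj₂ (f , i , i∈F , inj₂ e) with Deg2.only D′ e
      ...   | inj₁ refl = +-mono-≤ f (+-mono-≤ T.short (+-mono-≤ S.short (+-mono-≤ (R.empty i∈F) Q.short)))
      ...   | inj₂ refl = +-mono-≤ f (+-mono-≤ T.short (+-mono-≤ S.short (+-mono-≤ R.short (Q.empty i∈F))))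
      combined : Few-exceptions → length (F ++ T.list ++ S.list ++ R.list ++ Q.list) ≤ 8
      combined few rewrite length-++ F {T.list ++ S.list ++ R.list ++ Q.list}
                  | length-++ T.list {S.list ++ R.list ++ Q.list}
                  | length-++ S.list {R.list ++ Q.list}
                  | length-++ R.list {Q.list} = summands few

      disjoint-impossible : Few-exceptions → ¬ ¬ (∃ λ i → E′ v i × E′ w i)
      disjoint-impossible few none
        with pick (v ∷ w ∷ F ++ T.list ++ S.list ++ R.list ++ Q.list) (s≤s (s≤s (combined few)))
      ... | y , yv ∷ yw ∷ far = refute (plain⇒attached p (free (yv , yw) fF))
        where
        fF = ++⁻ˡ F far
        f₁ = ++⁻ʳ F far
        f₂ = ++⁻ʳ T.list f₁
        f₃ = ++⁻ʳ S.list f₂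
        fT = ++⁻ˡ T.list f₁
        fS = ++⁻ˡ S.list f₂
        fR = ++⁻ˡ R.list f₃
        fQ = ++⁻ʳ R.list f₃
        p : Plain y
        p = (yv , yw) , [ T.avoids fF fT , S.avoids fF fS ]′ ∘ Deg2.only D ,
                        [ R.avoids fF fR , Q.avoids fF fQ ]′ ∘ Deg2.only D′
        refute : ¬ Attached y
        refute (atW i e via) with Deg2.only D e
        ... | inj₁ refl = T.kills fF fT p via
        ... | inj₂ refl = S.kills fF fS p via
        refute (atV i e via) with Deg2.only D′ e
        ... | inj₁ refl = R.kills fF fR p via
        ... | inj₂ refl = Q.kills fF fQ p via
        refute (common i _ vi wi _ _) = none (i , vi , wi)

    module Overlap {t s q} (D : Deg2 E′ v t s) (D′ : Deg2 E′ w t q) where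
      module T = Block (block {t} {Pendant t} proj₁ (pendant-few t))
      module S = Block (block {s} {Via v w s} proj₁ (viaW-few s))
      module Q = Block (block {q} {Via w v q} proj₁ (viaV-few q))

      summands : Few-exceptions → length F + (length T.list + (length S.list + length Q.list)) ≤ 8
      summands few with few
      ... | inj₁ f = ≤-trans (+-mono-≤ f (+-mono-≤ T.short (+-mono-≤ S.short Q.short))) (m≤m+n 7 1)
      ... | inj₂ (f , i , i∈F , inj₁ e) with Deg2.only D e
      ...   | inj₁ refl = ≤-trans (+-mono-≤ f (+-mono-≤ (T.empty i∈F) (+-mono-≤ S.short Q.short))) (m≤m+n 6 2)
      ...   | inj₂ refl = ≤-trans (+-mono-≤ f (+-mono-≤ T.short (+-mono-≤ (S.empty i∈F) Q.short))) (m≤m+n 7 1)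
      summands few | inj₂ (f , i , i∈F , inj₂ e) with Deg2.only D′ e
      ...   | inj₁ refl = ≤-trans (+-mono-≤ f (+-mono-≤ (T.empty i∈F) (+-mono-≤ S.short Q.short))) (m≤m+n 6 2)
      ...   | inj₂ refl = ≤-trans (+-mono-≤ f (+-mono-≤ T.short (+-mono-≤ S.short (Q.empty i∈F)))) (m≤m+n 7 1)
      combined : Few-exceptions → length (F ++ T.list ++ S.list ++ Q.list) ≤ 8
      combined few rewrite length-++ F {T.list ++ S.list ++ Q.list}
                  | length-++ T.list {S.list ++ Q.list}
                  | length-++ S.list {Q.list} = summands few

      overlap-impossible : ¬ Few-exceptions
      overlap-impossible few
        with pick (v ∷ w ∷ F ++ T.list ++ S.list ++ Q.list) (s≤s (s≤s (combined few)))
      ... | y , yv ∷ yw ∷ far = refute (plain⇒attached p (free (yv , yw) fF))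
        where
        fF = ++⁻ˡ F far
        f₁ = ++⁻ʳ F far
        f₂ = ++⁻ʳ T.list f₁
        fT = ++⁻ˡ T.list f₁
        fS = ++⁻ˡ S.list f₂
        fQ = ++⁻ʳ S.list f₂
        p : Plain y
        p = (yv , yw) , [ T.avoids fF fT , S.avoids fF fS ]′ ∘ Deg2.only D ,
                        [ T.avoids fF fT , Q.avoids fF fQ ]′ ∘ Deg2.only D′
        -- The exit `h` is `E′`-adjacent to `t`, and one of the two `E′`-neighbours of `a` is `t`
        -- itself, so only `y` and σ remain. Hence `t`, although shared by `v` and `w`, attaches at
        -- most two vertices.
        pendant : ∀ {a h σ} → Deg2 E′ a t σ → E′ h t → Via a h t y → Pendant t y
        pendant {a} {h} {σ} d ht (ty , only) = ty , σ , bound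
          where
          bound : ∀ {x} → E t x → x ≡ y ⊎ x ≡ σ
          bound {x} e with only x e
          ... | inj₁ ax = inj₂ ([ (λ { refl → contradiction e irr }) , id ]′ (Deg2.only d ax))
          ... | inj₂ (inj₁ eq) = inj₁ eq
          ... | inj₂ (inj₂ refl) = ⊥-elim (excl (symm e) ht)
        refute : ¬ Attached y
        refute (atW i e via) with Deg2.only D e
        ... | inj₁ refl = T.kills fF fT p (pendant D (Deg2.va D′) via)
        ... | inj₂ refl = S.kills fF fS p via
        refute (atV i e via) with Deg2.only D′ e
        ... | inj₁ refl = T.kills fF fT p (pendant D′ (Deg2.va D) via)
        ... | inj₂ refl = Q.kills fF fQ p via
        refute (common i z vi wi iy only) with common-unique vi wi (Deg2.va D) (Deg2.va D′)
        ... | refl = T.kills fF fT p (iy , z , only)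

    cover-impossible : ¬ Few-exceptions
    cover-impossible few = Disjoint.disjoint-impossible D₀ D₀′ few λ { (i , vi , wi) →
      let σ , D = at D₀ vi ; σ′ , D′ = at D₀′ wi in Overlap.overlap-impossible D D′ few }
      where
      at : ∀ {a p q i} → Deg2 E′ a p q → E′ a i → ∃ λ σ → Deg2 E′ a i σ
      at {q = q} d e with Deg2.only d e
      ... | inj₁ refl = q , d
      ... | inj₂ refl = _ , flipDeg2 d

  -- Here the small part contains no `E′`-neighbour of `v` or `w`, so no block is saved and counting
  -- alone falls short. Instead `x₁` is deleted: it is not attached, so it lies in a cut of `E′`.
  module Bare {β x₁ x₂} (x₁≢x₂ : x₁ ≢ x₂) (i₁ : In β x₁) (i₂ : In β x₂)
              (only₂ : ∀ {i} → In β i → i ≡ x₁ ⊎ i ≡ x₂)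
              (free : ∀ {ρ} → Off v w ρ → ρ ≢ x₁ → ρ ≢ x₂ → Free ρ)
              (¬v₁ : ¬ E′ v x₁) (¬w₁ : ¬ E′ w x₁) (¬v₂ : ¬ E′ v x₂) (¬w₂ : ¬ E′ w x₂) where

    opposite : ∀ {i} → Off v w i → i ≢ x₁ → i ≢ x₂ → part i ≢ β
    opposite oi ne₁ ne₂ eq = [ ne₁ , ne₂ ]′ (only₂ (oi , eq))

    v-off : ∀ {i} → E′ v i → Off v w i × i ≢ x₁ × i ≢ x₂
    v-off e = ((λ { refl → irr′ e }) , (λ { refl → excl vw e })) ,
              (λ { refl → ¬v₁ e }) , (λ { refl → ¬v₂ e })

    w-off : ∀ {i} → E′ w i → Off v w i × i ≢ x₁ × i ≢ x₂
    w-off e = ((λ { refl → excl (symm vw) e }) , (λ { refl → irr′ e })) ,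
              (λ { refl → ¬w₁ e }) , (λ { refl → ¬w₂ e })

    complete₁ : ∀ {i} → Off v w i × i ≢ x₁ × i ≢ x₂ → E′ x₁ i
    complete₁ (oi , ne₁ , ne₂) =
      [ id , (λ d → contradiction (Deg2.va d) ¬v₁) ]′
      (cross (proj₁ i₁) oi λ eq → opposite oi ne₁ ne₂ (trans (sym eq) (proj₂ i₁)))

    complete₂ : ∀ {i} → Off v w i × i ≢ x₁ × i ≢ x₂ → E′ x₂ i
    complete₂ (oi , ne₁ , ne₂) =
      [ id , (λ d → contradiction (Deg2.va d) ¬v₂) ]′
      (cross (proj₁ i₂) oi λ eq → opposite oi ne₁ ne₂ (trans (sym eq) (proj₂ i₂)))

    x₁-unattached : ¬ Attached x₁
    x₁-unattached (atW i e (ix , _)) = excl (symm ix) (complete₁ (v-off e))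
    x₁-unattached (atV i e (ix , _)) = excl (symm ix) (complete₁ (w-off e))
    x₁-unattached (common i _ e _ ix _) = excl (symm ix) (complete₁ (v-off e))

    -- If `x₂` survived, it would hold `E′` together: it is adjacent to the whole opposite part,
    -- where `v` and `w` each have two neighbours, one of them different from `z`.
    second : ∀ {z} → z ≢ x₁ → Separation E′ x₁ z → z ≡ x₂
    second {z} z≢x₁ S = decidable-stable (z ≟ x₂) λ z≢x₂ → refute (≢-sym z≢x₂)
      where
      open Separation S hiding (cross)
      b = side x₂
      module _ (x₂≢z : x₂ ≢ z) where
        far-side : ∀ {i} → Off v w i → i ≢ x₁ → i ≢ x₂ → i ≢ z → side i ≡ b
        far-side oi ne₁ ne₂ iz = sym (mono (≢-sym x₁≢x₂ , x₂≢z) (ne₁ , iz) (complete₂ (oi , ne₁ , ne₂)))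
        hub : ∀ {a p q} → Deg2 E′ a p q → (∀ {i} → E′ a i → Off v w i × i ≢ x₁ × i ≢ x₂) →
              a ≢ x₁ → a ≢ z → side a ≡ b
        hub {a} {p} {q} d off a₁ az with p ≟ z
        ... | no pz = let o , n₁ , n₂ = off (Deg2.va d) in
          trans (mono (a₁ , az) (n₁ , pz) (Deg2.va d)) (far-side o n₁ n₂ pz)
        ... | yes refl = let o , n₁ , n₂ = off (Deg2.vb d) ; qz = ≢-sym (Deg2.a≢b d) in
          trans (mono (a₁ , az) (n₁ , qz) (Deg2.vb d)) (far-side o n₁ n₂ qz)
        refute : ⊥
        refute with wit (not b) | wit-off (not b) | wit-side (not b)
        ... | i | (ne₁ , iz) | si = ≡not⇒≢ si label
          where
          label : side i ≡ b
          label with i ≟ v | i ≟ w | i ≟ x₂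
          ... | yes refl | _ | _ = hub D₀ v-off ne₁ iz
          ... | no _ | yes refl | _ = hub D₀′ w-off ne₁ iz
          ... | no _ | no _ | yes refl = refl
          ... | no iv | no iw | no ne₂ = far-side (iv , iw) ne₁ ne₂ iz

    module _ (S : Separation E′ x₁ x₂) where
      open Separation S renaming (cross to S-cross)

      off-v : Off x₁ x₂ v
      off-v = ≢-sym (proj₁ (proj₁ i₁)) , ≢-sym (proj₁ (proj₁ i₂))

      off-w : Off x₁ x₂ w
      off-w = ≢-sym (proj₂ (proj₁ i₁)) , ≢-sym (proj₂ (proj₁ i₂))

      v-label : ∀ {i} → E′ v i → side v ≡ side i
      v-label e = mono off-v (proj₂ (v-off e)) e

      w-label : ∀ {i} → E′ w i → side w ≡ side i
      w-label e = mono off-w (proj₂ (w-off e)) e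

      joined : ∀ {i j} → Off x₁ x₂ i → Off x₁ x₂ j → side i ≢ side j → E i j
      joined oi oj ne = toE (λ { refl → ne refl }) (S-cross oi oj ne)

      plain′ : ∀ {y} → Off v w y → y ≢ t₀ → y ≢ s₀ → y ≢ r₀ → y ≢ q₀ → Plain y
      plain′ oy yt ys yr yq = oy , [ yt , ys ]′ ∘ Deg2.only D₀ , [ yr , yq ]′ ∘ Deg2.only D₀′

      -- An `E′`-neighbour of `v` and one of `w` lie on opposite sides, so they are `E`-adjacent.
      -- `Via` does not allow this edge, and a common neighbour cannot exist.
      apart : side v ≢ side w → ⊥
      apart vw≢ with pick! (v ∷ w ∷ t₀ ∷ s₀ ∷ r₀ ∷ q₀ ∷ x₁ ∷ x₂ ∷ [])
      ... | y , yv ∷ yw ∷ yt ∷ ys ∷ yr ∷ yq ∷ y₁ ∷ y₂ ∷ [] =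
        refute (plain⇒attached (plain′ (yv , yw) yt ys yr yq) (free (yv , yw) y₁ y₂))
        where
        refute : ¬ Attached y
        refute (atW i e (_ , only)) with only r₀ (joined (proj₂ (v-off e)) (proj₂ (w-off (Deg2.va D₀′)))
          λ eq → vw≢ (trans (v-label e) (trans eq (sym (w-label (Deg2.va D₀′))))))
        ... | inj₁ e′ = vw≢ (trans (v-label e′) (sym (w-label (Deg2.va D₀′))))
        ... | inj₂ (inj₁ eq) = yr (sym eq)
        ... | inj₂ (inj₂ refl) = irr′ (Deg2.va D₀′)
        refute (atV i e (_ , only)) with only t₀ (joined (proj₂ (w-off e)) (proj₂ (v-off (Deg2.va D₀)))
          λ eq → vw≢ (trans (v-label (Deg2.va D₀)) (trans (sym eq) (sym (w-label e)))))
        ... | inj₁ e′ = vw≢ (trans (v-label (Deg2.va D₀)) (sym (w-label e′)))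
        ... | inj₂ (inj₁ eq) = yt (sym eq)
        ... | inj₂ (inj₂ refl) = irr′ (Deg2.va D₀)
        refute (common i _ vi wi _ _) = vw≢ (trans (v-label vi) (sym (w-label wi)))

      -- A vertex `j` of the other side is `E`-adjacent to all `E′`-neighbours of `v` and `w`. This
      -- excludes `Via` and makes `j` an `E`-neighbour of the unique common neighbour, which then
      -- has room for only one more vertex, while two plain ones need it.
      together : side v ≡ side w → ⊥
      together v≡w with wit (not (side v)) | wit-off (not (side v)) | wit-side (not (side v))
      ... | j | oj | sj = refute
        where
        v≢j : side v ≢ side j
        v≢j eq = ≡not⇒≢ sj (sym eq)
        ¬vj : ¬ E′ v j
        ¬vj e = v≢j (v-label e)
        ¬wj : ¬ E′ w j
        ¬wj e = v≢j (trans v≡w (w-label e))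
        v-joined : ∀ {i} → E′ v i → E i j
        v-joined e = joined (proj₂ (v-off e)) oj λ eq → v≢j (trans (v-label e) eq)
        w-joined : ∀ {i} → E′ w i → E i j
        w-joined e = joined (proj₂ (w-off e)) oj λ eq → v≢j (trans v≡w (trans (w-label e) eq))
        jv : j ≢ v
        jv refl = v≢j refl
        jw : j ≢ w
        jw refl = v≢j v≡w
        Common : Fin n → Set
        Common y = ∃ λ i → E′ v i × E′ w i × E i y × (∀ {x} → E i x → x ≡ y ⊎ x ≡ j)
        attached⇒common : ∀ {y} → y ≢ j → Attached y → Common y
        attached⇒common yj (atW i e (_ , only)) =
          ⊥-elim ([ ¬vj , [ ≢-sym yj , jw ]′ ]′ (only j (v-joined e)))
        attached⇒common yj (atV i e (_ , only)) =
          ⊥-elim ([ ¬wj , [ ≢-sym yj , jv ]′ ]′ (only j (w-joined e)))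
        attached⇒common yj (common i z vi wi iy only) with only (v-joined vi)
        ... | inj₁ eq = contradiction (sym eq) yj
        ... | inj₂ refl = i , vi , wi , iy , only
        refute : ⊥
        refute with pick! (v ∷ w ∷ t₀ ∷ s₀ ∷ r₀ ∷ q₀ ∷ x₁ ∷ x₂ ∷ j ∷ [])
        ... | y , yv ∷ yw ∷ yt ∷ ys ∷ yr ∷ yq ∷ y₁ ∷ y₂ ∷ yj ∷ []
          with pick! (v ∷ w ∷ t₀ ∷ s₀ ∷ r₀ ∷ q₀ ∷ x₁ ∷ x₂ ∷ j ∷ y ∷ [])
        ... | y′ , yv′ ∷ yw′ ∷ yt′ ∷ ys′ ∷ yr′ ∷ yq′ ∷ y₁′ ∷ y₂′ ∷ yj′ ∷ yy′ ∷ []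
          with attached⇒common yj
                 (plain⇒attached (plain′ (yv , yw) yt ys yr yq) (free (yv , yw) y₁ y₂))
             | attached⇒common yj′
                 (plain⇒attached (plain′ (yv′ , yw′) yt′ ys′ yr′ yq′) (free (yv′ , yw′) y₁′ y₂′))
        ... | i , vi , wi , iy , _ | i′ , vi′ , wi′ , _ , only′ with common-unique vi wi vi′ wi′
        ...   | refl = [ ≢-sym yy′ , yj ]′ (only′ iy)

    bare-impossible : ⊥
    bare-impossible with deletion x₁
    ... | z , _ , inj₁ S = x₁-unattached (separation⇒attached (proj₁ i₁) S)
    ... | z , z≢x₁ , inj₂ S with second z≢x₁ S
    ...   | refl with Separation.side S v Bool.≟ Separation.side S w
    ...     | yes eq = together S eq
    ...     | no ne = apart S ne

  exceptional-impossible : ∀ {β x₁ x₂} → In β x₁ → In β x₂ →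
    (∀ {i} → In β i → i ≡ x₁ ⊎ i ≡ x₂) →
    (∀ {ρ} → Off v w ρ → ρ ≢ x₁ → ρ ≢ x₂ → Free ρ) →
    ¬ (∃ λ i → i ∈ x₁ ∷ x₂ ∷ [] × (E′ v i ⊎ E′ w i))
  exceptional-impossible {β} {x₁} {x₂} i₁ i₂ only₂ free ex =
    cover-impossible (x₁ ∷ x₂ ∷ []) (λ { oρ (p ∷ q ∷ []) → free oρ p q }) blocked
      (inj₂ (≤-refl , ex))
    where
    inside : ∀ {i} → i ∈ x₁ ∷ x₂ ∷ [] → In β i
    inside (here refl) = i₁
    inside (there (here refl)) = i₂
    blocked : ∀ {i y} → i ∈ x₁ ∷ x₂ ∷ [] → Plain y → All (y ≢_) (x₁ ∷ x₂ ∷ []) → ¬ E i y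
    blocked i∈ (oy , ¬vy , _) (y₁ ∷ y₂ ∷ []) e with inside i∈
    ... | oi , pi = [ excl e , (λ d → ¬vy (Deg2.vb d)) ]′
      (cross oi oy λ eq → [ y₁ , y₂ ]′ (only₂ (oy , trans (sym eq) pi)))

  impossible : ⊥
  impossible with freeVertices J
  ... | allFree free = cover-impossible [] (λ oρ _ → free oρ) (λ ()) (inj₁ z≤n)
  ... | smallSide β x₁ x₂ x₁≢x₂ i₁ i₂ only₂ free
    with Co.E? v x₁ | Co.E? w x₁ | Co.E? v x₂ | Co.E? w x₂
  ... | no ¬v₁ | no ¬w₁ | no ¬v₂ | no ¬w₂ =
    Bare.bare-impossible x₁≢x₂ i₁ i₂ only₂ free ¬v₁ ¬w₁ ¬v₂ ¬w₂
  ... | yes e | _ | _ | _ = exceptional-impossible i₁ i₂ only₂ free (x₁ , here refl , inj₁ e)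
  ... | no _ | yes e | _ | _ = exceptional-impossible i₁ i₂ only₂ free (x₁ , here refl , inj₂ e)
  ... | no _ | no _ | yes e | _ =
    exceptional-impossible i₁ i₂ only₂ free (x₂ , there (here refl) , inj₁ e)
  ... | no _ | no _ | no _ | yes e =
    exceptional-impossible i₁ i₂ only₂ free (x₂ , there (here refl) , inj₂ e)

-- Vertex cuts in general

size : ∀ {n} → (Fin n → Bool) → ℕ
size {zero}  Z = 0
size {suc n} Z = (if Z zero then 1 else 0) + size (Z ∘ suc)

size-mono : ∀ {n} {P Q : Fin n → Bool} → (∀ i → P i ≡ true → Q i ≡ true) → size P ≤ size Q
size-mono {zero}  _ = z≤n
size-mono {suc n} {P} {Q} sub with P zero in p | Q zero in q
... | false | false = size-mono (sub ∘ suc)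
... | false | true  = m≤n⇒m≤1+n (size-mono (sub ∘ suc))
... | true  | true  = s≤s (size-mono (sub ∘ suc))
... | true  | false with trans (sym q) (sub zero p)
...   | ()

size-strict : ∀ {n} {P Q : Fin n → Bool} → (∀ i → P i ≡ true → Q i ≡ true) →
              ∀ x → Q x ≡ true → P x ≡ false → size P < size Q
size-strict {suc n} {P} {Q} sub zero qx px rewrite qx | px = s≤s (size-mono (sub ∘ suc))
size-strict {suc n} {P} {Q} sub (suc x) qx px with P zero in p | Q zero in q
... | false | false = size-strict (sub ∘ suc) x qx px
... | false | true  = m≤n⇒m≤1+n (size-strict (sub ∘ suc) x qx px)
... | true  | true  = s≤s (size-strict (sub ∘ suc) x qx px)
... | true  | false with trans (sym q) (sub zero p)
...   | ()

record Fragment {n} (E : Fin n → Fin n → Set) (u z : Fin n) (Z : Fin n → Set) : Set where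
  field
    Z?       : ∀ i → Dec (Z i)
    inner    : ∃ Z
    outer    : ∃ λ r → ¬ Z r × Off u z r
    u∉       : ¬ Z u
    z∉       : ¬ Z z
    boundary : ∀ {i j} → Z i → E i j → Z j ⊎ j ≡ u ⊎ j ≡ z

module Fragments {n} {E E′ : Fin n → Fin n → Set} (C : Critical E E′) where
  open Critical C
  open Basics C

  fragment-size : ∀ {u z Z} → Fragment E u z Z → ℕ
  fragment-size fr = size (does ∘ Fragment.Z? fr)

  smaller : ∀ {u z Z u′ z′ Z′} (fr : Fragment E u z Z) (fr′ : Fragment E u′ z′ Z′) →
            (∀ {i} → Z′ i → Z i) → ∀ {x} → Z x → ¬ Z′ x → fragment-size fr′ < fragment-size fr
  smaller fr fr′ sub {x} zx ¬z′x = size-strict inclusion x (dec-true (Z? x) zx) (dec-false (Z?′ x) ¬z′x)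
    where
    open Fragment fr
    open Fragment fr′ using () renaming (Z? to Z?′)
    inclusion : ∀ i → does (Z?′ i) ≡ true → does (Z? i) ≡ true
    inclusion i h with Z?′ i
    ... | yes z′ = dec-true (Z? i) (sub z′)

  -- Induction on the size, uncrossing the fragment with a vertex cut through one of its vertices.
  deg2-in-fragment : ∀ k {u z Z} (fr : Fragment E u z Z) → fragment-size fr ≤ k →
    (∀ {x} → Z x → ∃ λ z′ → z′ ≢ x × Separation E x z′) →
    ∃ λ d → Z d × ∃₂ λ a b → Deg2 E d a b
  deg2-in-fragment zero fr size≤ _ with Fragment.inner fr
  ... | x , zx = contradiction size≤ (<⇒≱ (≤-trans (s≤s z≤n)
    (size-strict {P = λ _ → false} (λ _ ()) x (dec-true (Fragment.Z? fr x) zx) refl)))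
  deg2-in-fragment (suc k) {u} {z} {Z} fr size≤ cuts with Fragment.inner fr
  ... | x , zx with cuts zx
  ...   | z′ , z′≢x , S = go
    where
    open Fragment fr renaming (boundary to Z-boundary)
    open Separation S
    x≢z′ = ≢-sym z′≢x

    T : Bool → Fin n → Set
    T β i = Off x z′ i × side i ≡ β
    T? : ∀ β i → Dec (T β i)
    T? β i = (¬? (i ≟ x) ×-dec ¬? (i ≟ z′)) ×-dec (side i Bool.≟ β)
    T-closed : ∀ {β i j} → T β i → Off x z′ j → E i j → T β j
    T-closed (oi , si) oj e = oj , trans (sym (mono oi oj e)) si
    T-boundary : ∀ {β i j} → T β i → E i j → T β j ⊎ j ≡ x ⊎ j ≡ z′
    T-boundary {j = j} ti e with j ≟ x | j ≟ z′
    ... | yes p | _ = inj₂ (inj₁ p)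
    ... | no _ | yes q = inj₂ (inj₂ q)
    ... | no p | no q = inj₁ (T-closed ti (p , q) e)

    Rest : Fin n → Set
    Rest i = ¬ Z i × Off u z i
    rest? : ∀ i → Dec (Rest i)
    rest? i = ¬? (Z? i) ×-dec (¬? (i ≟ u) ×-dec ¬? (i ≟ z))
    rest-Z : ∀ {i j} → Rest i → E i j → ¬ Z j
    rest-Z (nz , iu , iz) e zj = [ nz , [ iu , iz ]′ ]′ (Z-boundary zj (symm e))

    recurse : ∀ {u₁ z₁ Z₁} (fr₁ : Fragment E u₁ z₁ Z₁) → (∀ {i} → Z₁ i → Z i) → ¬ Z₁ x →
              ∃ λ d → Z d × ∃₂ λ a b → Deg2 E d a b
    recurse fr₁ sub ¬x =
      let d , zd , deg = deg2-in-fragment k fr₁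
                           (s≤s⁻¹ (≤-trans (smaller fr fr₁ sub zx ¬x) size≤)) (cuts ∘ sub)
      in d , sub zd , deg

    -- Vertices of this side outside Z could be left only through `z′`, so there are none. The side
    -- is then a fragment inside Z that lacks `x`.
    missed-side : ∀ β → ¬ T β u → ¬ T β z → ∃ λ d → Z d × ∃₂ λ a b → Deg2 E d a b
    missed-side β ¬u ¬z = recurse record
      { Z? = T? β
      ; inner = wit β , wit-off β , wit-side β
      ; outer = wit (not β) , (λ t → ≡not⇒≢ (wit-side (not β)) (proj₂ t)) , wit-off (not β)
      ; u∉ = λ t → proj₁ (proj₁ t) refl ; z∉ = λ t → proj₂ (proj₁ t) refl
      ; boundary = T-boundary } inside (λ t → proj₁ (proj₁ t) refl)
      where
      inside : ∀ {i} → T β i → Z i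
      inside {i} ti = decidable-stable (Z? i) λ nz → boundary (λ j → Rest j × T β j)
        (λ j → rest? j ×-dec T? β j) z′ i x
        ((nz , (λ { refl → ¬u ti }) , (λ { refl → ¬z ti })) , ti) (proj₂ (proj₁ ti))
        (λ { ((nx , _) , _) → nx zx }) x≢z′
        λ {a} {y} az yz (ra , ta) ¬py e →
          let y≢x = λ { refl → rest-Z ra e zx }
              ty = T-closed ta (y≢x , yz) e
          in ¬py ((rest-Z ra e , (λ { refl → ¬u ty }) , (λ { refl → ¬z ty })) , ty)

    -- If `z′` were in Z, the vertices beyond the fragment on one side would hang on whichever of
    -- `u` and `z` shares that side. With `z′` outside, either Z is just {x}, or the part of Z on
    -- one side is a smaller fragment, attached through `x` and one of `u`, `z`.
    split : Off x z′ u → Off x z′ z → side u ≢ side z → ∃ λ d → Z d × ∃₂ λ a b → Deg2 E d a b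
    split ou oz ne with Z? z′
    ... | yes zz′ = ⊥-elim (absurd outer)
      where
      absurd : (∃ λ r → ¬ Z r × Off u z r) → ⊥
      absurd (r , rr@(nr , _)) = hang (side r Bool.≟ side u)
        where
        off-Z : ∀ {i} → ¬ Z i → Off x z′ i
        off-Z nz = (λ { refl → nz zx }) , (λ { refl → nz zz′ })
        at : ∀ {h h′} → ¬ Z h → (∀ {i} → Off u z i → i ≢ h) → (∀ {i} → i ≢ h → i ≢ h′ → Off u z i) →
             side r ≢ side h′ → ⊥
        at {h} {h′} nh off-h off ne′ = boundary (λ i → Rest i × T (side r) i)
          (λ i → rest? i ×-dec T? (side r) i) h r x (rr , off-Z nr , refl) (off-h (proj₂ rr))
          (λ { ((nx , _) , _) → nx zx }) (λ { refl → nh zx })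
          λ {a} {y} ah yh (ra , ta) ¬py e →
            let ny = rest-Z ra e
                ty = T-closed ta (off-Z ny) e
            in ¬py ((ny , off yh (λ { refl → ne′ (sym (proj₂ ty)) })) , ty)
        hang : Dec (side r ≡ side u) → ⊥
        hang (yes eq) = at {u} {z} u∉ proj₁ _,_ (λ eq′ → ne (trans (sym eq) eq′))
        hang (no ne′) = at {z} {u} z∉ proj₂ (λ p q → q , p) ne′
    ... | no nz′ with any? (λ i → Z? i ×-dec ¬? (i ≟ x))
    ...   | no none = x , zx , u , z , within⇒Deg2 λ e →
      [ (λ zj → contradiction (_ , zj , λ { refl → irr e }) none) , id ]′ (Z-boundary zx e)
    ...   | yes (i , zi , i≢x) = by (side i Bool.≟ side u)
      where
      corner : ∀ {h h′} → side i ≢ side h′ → Off x z′ h′ → ¬ Z h → ¬ Z h′ → h′ ≢ h →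
               (∀ {j} → j ≡ u ⊎ j ≡ z → j ≡ h ⊎ j ≡ h′) →
               ∃ λ d → Z d × ∃₂ λ a b → Deg2 E d a b
      corner {h} {h′} ne′ oh′ nh nh′ h′≢h cover = recurse record
        { Z? = λ j → Z? j ×-dec T? (side i) j
        ; inner = i , zi , (i≢x , λ { refl → nz′ zi }) , refl
        ; outer = h′ , (λ { (zh′ , _) → nh′ zh′ }) , proj₁ oh′ , h′≢h
        ; u∉ = λ t → proj₁ (proj₁ (proj₂ t)) refl
        ; z∉ = λ t → nh (proj₁ t)
        ; boundary = bd } proj₁ (λ t → proj₁ (proj₁ (proj₂ t)) refl)
        where
        bd : ∀ {a j} → Z a × T (side i) a → E a j → (Z j × T (side i) j) ⊎ j ≡ x ⊎ j ≡ h
        bd {a} {j} (za , ta) e with Z-boundary za e | j ≟ x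
        ... | _ | yes jx = inj₂ (inj₁ jx)
        ... | inj₁ zj | no jx = inj₁ (zj , T-closed ta (jx , λ { refl → nz′ zj }) e)
        ... | inj₂ uz | no jx with cover uz
        ...   | inj₁ jh = inj₂ (inj₂ jh)
        ...   | inj₂ refl = contradiction (sym (proj₂ (T-closed ta oh′ e))) ne′
      by : Dec (side i ≡ side u) → ∃ λ d → Z d × ∃₂ λ a b → Deg2 E d a b
      by (yes eq) = corner {u} {z} (λ eq′ → ne (trans (sym eq) eq′)) oz u∉ z∉
        (λ { refl → ne refl }) id
      by (no ne′) = corner {z} {u} ne′ ou z∉ u∉ (λ { refl → ne refl }) Sum.swap

    go : ∃ λ d → Z d × ∃₂ λ a b → Deg2 E d a b
    go with T? true u | T? true z | T? false u | T? false z
    ... | no p | no q | _ | _ = missed-side true p q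
    ... | _ | _ | no p | no q = missed-side false p q
    ... | yes (ou , su) | _ | _ | yes (oz , sz) = split ou oz λ eq →
      contradiction (trans (sym su) (trans eq sz)) (λ ())
    ... | _ | yes (oz , sz) | yes (ou , su) | _ = split ou oz λ eq →
      contradiction (trans (sym sz) (trans (sym eq) su)) (λ ())
    ... | yes (_ , su) | no _ | yes (_ , su′) | no _ = contradiction (trans (sym su) su′) (λ ())
    ... | no _ | yes (_ , sz) | no _ | yes (_ , sz′) = contradiction (trans (sym sz) sz′) (λ ())

tight-impossible : ∀ {n} {E E′ : Fin n → Fin n → Set} (C : Critical E E′) {v w t s} →
                   Join E′ v w → ¬ Deg2 E′ v t s
tight-impossible C {w = w} J D with Basics.degree (swap C) w
... | inj₁ (_ , _ , D′) = TightTight.impossible C J D D′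
... | inj₂ three = TightLoose.impossible C J D three

pairsOrSingleton : ∀ {n a b} (side : Fin n → Bool) (wit : Bool → Fin n) →
  (∀ β → Off a b (wit β)) → (∀ β → side (wit β) ≡ β) →
  (∀ β → ∃₂ λ x y → x ≢ y × (Off a b x × side x ≡ β) × (Off a b y × side y ≡ β)) ⊎
  (∃ λ β → ∀ {i} → Off a b i → side i ≡ β → i ≡ wit β)
pairsOrSingleton {n} {a} {b} side wit wit-off wit-side = combine (second true) (second false)
  where
  Pair : Bool → Set
  Pair β = ∃₂ λ x y → x ≢ y × (Off a b x × side x ≡ β) × (Off a b y × side y ≡ β)
  Single : Bool → Set
  Single β = ∀ {i} → Off a b i → side i ≡ β → i ≡ wit β
  second : ∀ β → Pair β ⊎ Single β
  second β with any? (λ x → ¬? (wit β ≟ x) ×-dec ((¬? (x ≟ a) ×-dec ¬? (x ≟ b)) ×-dec (side x Bool.≟ β)))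
  ... | yes (x , ne , ix) = inj₁ (wit β , x , ne , (wit-off β , wit-side β) , ix)
  ... | no none = inj₂ λ {i} oi si → decidable-stable (i ≟ wit β) λ ne → none (i , ≢-sym ne , oi , si)
  combine : Pair true ⊎ Single true → Pair false ⊎ Single false →
            (∀ β → Pair β) ⊎ ∃ λ β → Single β
  combine (inj₁ p) (inj₁ q) = inj₁ λ { true → p ; false → q }
  combine (inj₂ p) _ = inj₂ (true , p)
  combine _ (inj₂ q) = inj₂ (false , q)

module Structure {n} {E E′ : Fin n → Fin n → Set} (C : Critical E E′) where
  open Critical C
  open Basics C
  private module Co = Basics (swap C)

  -- The edge from `t` to `v` is contracted in `E′`. Its ends form no cut, because `v` has only `s`
  -- besides `t`. So the complement of the contraction has a cut vertex `c`, whose two sides are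
  -- `E′`-complete to each other except for the pair of `t` and `s`. By `tight-impossible` this is
  -- no `Join`, so one side is a single vertex `p`. The alternatives are: `p` is neither `t` nor
  -- `s`, is `t`, or is `s`.
  codeg2-structure : ∀ {v t s} → Deg2 E′ v t s →
    (∃₂ λ p c → Deg2 E p v c) ⊎ (∃ λ c → Deg2 E t c s) ⊎ (∃ λ c → Deg2 E s c t)
  codeg2-structure {v} {t} {s} D with contraction′ (symm′ (Deg2.va D))
  ... | inj₁ S with Co.nbrIn (swapSep S) true | Co.nbrIn (swapSep S) false
  ...   | i , (_ , it) , si , vi | j , (_ , jt) , sj , vj
    with Deg2.only D vi | Deg2.only D vj
  ...     | inj₁ eq | _ = contradiction eq it
  ...     | _ | inj₁ eq = contradiction eq jt
  ...     | inj₂ refl | inj₂ refl = contradiction (trans (sym si) sj) λ ()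
  codeg2-structure {v} {t} {s} D | inj₂ (c , c≢v , S) = result
    where
    open ContractionCut S
    nearly-complete : ∀ {i j} → Off v c i → Off v c j → side i ≢ side j → E′ i j ⊎ Deg2 E′ v i j
    nearly-complete {i} {j} oi oj ne with total {i} {j} (λ { refl → ne refl })
    ... | inj₂ e′ = inj₁ e′
    ... | inj₁ e with i ≟ t | j ≟ t
    ...   | no it | no jt = contradiction
      (mono oi oj e (λ eq → contradiction eq it) (λ eq → contradiction eq jt)) ne
    ...   | yes refl | yes refl = contradiction refl ne
    ...   | yes refl | no jt with total {v} {j} (≢-sym (proj₁ oj))
    ...     | inj₁ vj = contradiction (mono oi oj e (λ _ → vj) (λ eq → contradiction eq jt)) ne
    ...     | inj₂ vj with Deg2.only D vj
    ...       | inj₁ eq = contradiction eq jt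
    ...       | inj₂ refl = inj₂ D
    nearly-complete {i} {j} oi oj ne | inj₁ e | no it | yes refl with total {v} {i} (≢-sym (proj₁ oi))
    ...     | inj₁ vi = contradiction (mono oi oj e (λ eq → contradiction eq it) (λ _ → vi)) ne
    ...     | inj₂ vi with Deg2.only D vi
    ...       | inj₁ eq = contradiction eq it
    ...       | inj₂ refl = inj₂ (flipDeg2 D)
    result : (∃₂ λ p c → Deg2 E p v c) ⊎ (∃ λ c → Deg2 E t c s) ⊎ (∃ λ c → Deg2 E s c t)
    result with pairsOrSingleton side wit wit-off wit-side
    ... | inj₁ pairs = ⊥-elim (tight-impossible C {v} {c} record
      { v≢w = ≢-sym c≢v ; part = side ; two = pairs ; cross = nearly-complete } D)
    ... | inj₂ (β , single) = classify
      where
      p = wit β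
      nbr : ∀ {x} → E p x → x ≡ v ⊎ x ≡ c ⊎ Deg2 E′ v p x
      nbr {x} e with x ≟ v | x ≟ c
      ... | yes eq | _ = inj₁ eq
      ... | no _ | yes eq = inj₂ (inj₁ eq)
      ... | no xv | no xc = [ (λ e′ → ⊥-elim (excl e e′)) , inj₂ ∘ inj₂ ]′
        (nearly-complete (wit-off β) (xv , xc) λ eq →
          irr (subst (E p) (single (xv , xc) (trans (sym eq) (wit-side β))) e))
      classify : (∃₂ λ p c → Deg2 E p v c) ⊎ (∃ λ c → Deg2 E t c s) ⊎ (∃ λ c → Deg2 E s c t)
      classify with p ≟ t | p ≟ s
      ... | yes pt | _ = inj₂ (inj₁ (c , subst (λ i → Deg2 E i c s) pt (within⇒Deg2 λ {x} e →
        [ (λ { refl → ⊥-elim (excl (symm e) (subst (E′ v) (sym pt) (Deg2.va D))) })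
        , [ inj₁ , (λ d → inj₂ ([ (λ xt → contradiction (trans pt (sym xt)) (Deg2.a≢b d)) , id ]′
                                 (Deg2.only D (Deg2.vb d)))) ]′ ]′ (nbr e))))
      ... | no _ | yes ps = inj₂ (inj₂ (c , subst (λ i → Deg2 E i c t) ps (within⇒Deg2 λ {x} e →
        [ (λ { refl → ⊥-elim (excl (symm e) (subst (E′ v) (sym ps) (Deg2.vb D))) })
        , [ inj₁ , (λ d → inj₂ ([ id , (λ xs → contradiction (trans ps (sym xs)) (Deg2.a≢b d)) ]′
                                 (Deg2.only D (Deg2.vb d)))) ]′ ]′ (nbr e))))
      ... | no pt | no ps = inj₁ (p , c , within⇒Deg2 λ e →
        [ inj₁ , [ inj₂ , (λ d → ⊥-elim ([ pt , ps ]′ (Deg2.only D (Deg2.va d)))) ]′ ]′ (nbr e))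

module Cuts {n} {E E′ : Fin n → Fin n → Set} (C : Critical E E′) where
  open Critical C
  open Basics C
  open Joins C
  open Fragments C
  private module Co = Basics (swap C)

  module _ {v w} (v≢w : v ≢ w) (S : Separation E v w)
           (pairs : ∀ β → ∃₂ λ x y → x ≢ y × (Off v w x × Separation.side S x ≡ β)
                                           × (Off v w y × Separation.side S y ≡ β)) where
    open Separation S

    private
      complete′ : ∀ {i j} → Off v w i → Off v w j → side i ≢ side j → E′ i j
      complete′ oi oj ne = toE′ (λ { refl → ne refl }) (cross oi oj ne)

      J : Join E′ v w
      J = record { v≢w = v≢w ; part = side ; two = pairs
                 ; cross = λ oi oj ne → inj₁ (complete′ oi oj ne) }

      J′ : Join E′ w v
      J′ = record { v≢w = ≢-sym v≢w ; part = side
        ; two = λ β → let x , y , x≢y , ((xv , xw) , px) , ((yv , yw) , py) = pairs β in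
                      x , y , x≢y , ((xw , xv) , px) , ((yw , yv) , py)
        ; cross = λ { (p , q) (p′ , q′) ne → inj₁ (complete′ (q , p) (q′ , p′) ne) } }

      open Join J using (In; Free; avoid)

      hub-loose : ∀ {i a b} → i ≡ v ⊎ i ≡ w → ¬ Deg2 E′ i a b
      hub-loose (inj₁ refl) d = tight-impossible C J d
      hub-loose (inj₂ refl) d = tight-impossible C J′ d

      hub? : ∀ i → Dec (i ≡ v ⊎ i ≡ w)
      hub? i = i ≟ v ⊎-dec i ≟ w

      freeSide : ∃ λ β → ∀ {ρ} → In β ρ → Free ρ
      freeSide with freeVertices J
      ... | allFree free = true , λ { (oρ , _) → free oρ }
      ... | smallSide β x₁ x₂ _ (_ , p₁) (_ , p₂) _ free = not β , λ { (oρ , pρ) →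
        free oρ (λ { refl → ≡not⇒≢ pρ p₁ }) (λ { refl → ≡not⇒≢ pρ p₂ }) }

    -- Deleting a vertex of a free part cannot give `E′` a cut vertex, so every vertex of that part
    -- lies in a cut of `E`, and some `d` there has `E`-degree two. Then `codeg2-structure` yields a
    -- vertex of `E′`-degree two adjacent to `d` in `E′` or in `E`. It is not `v` or `w` by
    -- `tight-impossible`; any other vertex is `E′`-adjacent to the whole opposite part, which does
    -- not fit its two prescribed neighbours.
    big-cut-impossible : ⊥
    big-cut-impossible with freeSide
    ... | β , free = deg2-impossible (deg2-in-fragment _ fragment ≤-refl cuts)
      where
      fragment : Fragment E v w (In β)
      fragment = record
        { Z? = λ i → (¬? (i ≟ v) ×-dec ¬? (i ≟ w)) ×-dec (side i Bool.≟ β)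
        ; inner = wit β , wit-off β , wit-side β
        ; outer = wit (not β) , (λ t → ≡not⇒≢ (wit-side (not β)) (proj₂ t)) , wit-off (not β)
        ; u∉ = λ t → proj₁ (proj₁ t) refl
        ; z∉ = λ t → proj₂ (proj₁ t) refl
        ; boundary = λ { {i} {j} (oi , si) e → bd oi si e (j ≟ v) (j ≟ w) } }
        where
        bd : ∀ {i j} → Off v w i → side i ≡ β → E i j → Dec (j ≡ v) → Dec (j ≡ w) →
             In β j ⊎ j ≡ v ⊎ j ≡ w
        bd _ _ _ (yes p) _ = inj₂ (inj₁ p)
        bd _ _ _ (no _) (yes q) = inj₂ (inj₂ q)
        bd oi si e (no p) (no q) = inj₁ ((p , q) , trans (sym (mono oi (p , q) e)) si)
      cuts : ∀ {x} → In β x → ∃ λ z′ → z′ ≢ x × Separation E x z′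
      cuts {x} ix with deletion x
      ... | z′ , ne , inj₁ S′ = z′ , ne , S′
      ... | z′ , ne , inj₂ S′ with separation-join J (proj₁ ix) (free ix) S′
      ...   | inj₁ h = ⊥-elim (hub-loose (inj₁ refl) (Co.within⇒Deg2 h))
      ...   | inj₂ (inj₁ h) = ⊥-elim (hub-loose (inj₂ refl) (Co.within⇒Deg2 h))
      ...   | inj₂ (inj₂ h) = ⊥-elim (few-coneighbours-impossible J x z′ h)
      deg2-impossible : (∃ λ d → In β d × ∃₂ λ a b → Deg2 E d a b) → ⊥
      deg2-impossible (d , (od , sd) , a , b , D) with Structure.codeg2-structure (swap C) D
      ... | inj₁ (p , c , D′) with hub? p
      ...   | yes hub = hub-loose hub D′
      ...   | no op with avoid (free (od , sd)) (not (side p)) c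
      ...     | k , (ok , sk) , kd , kc =
        [ kd , kc ]′ (Deg2.only D′ (complete′ (op ∘ inj₁ , op ∘ inj₂) ok (≢-sym (≡not⇒≢ sk))))
      deg2-impossible (d , (od , sd) , a , b , D) | inj₂ rest =
        [ (λ { (c , D′) → nbr (Deg2.va D) (Deg2.vb D) D′ })
        , (λ { (c , D′) → nbr (Deg2.vb D) (Deg2.va D) D′ }) ]′ rest
        where
        nbr : ∀ {a b c} → E d a → E d b → ¬ Deg2 E′ a c b
        nbr {a} {b} {c} da db D′ with hub? a
        ... | yes hub = hub-loose hub D′
        ... | no oa with avoid (free (od , sd)) (not β) c
        ...   | k , (ok , sk) , _ , kc with Deg2.only D′ (complete′ (oa ∘ inj₁ , oa ∘ inj₂) ok
                  λ eq → ≡not⇒≢ sk (trans (sym eq)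
                    (trans (sym (mono od (oa ∘ inj₁ , oa ∘ inj₂) da)) sd)))
        ...     | inj₁ eq = kc eq
        ...     | inj₂ refl = ≡not⇒≢ sk (trans (sym (mono od ok db)) sd)

  separation⇒Deg2 : ∀ {a z} → a ≢ z → Separation E a z → ∃ λ p → Deg2 E p a z
  separation⇒Deg2 {a} {z} a≢z S
    with pairsOrSingleton (Separation.side S) (Separation.wit S) (Separation.wit-off S) (Separation.wit-side S)
  ... | inj₁ pairs = ⊥-elim (big-cut-impossible a≢z S pairs)
  ... | inj₂ (β , single) = wit β , within⇒Deg2 λ {x} e →
    decidable-stable (x ≟ a ⊎-dec x ≟ z) λ h →
      let ox = h ∘ inj₁ , h ∘ inj₂ in
      irr (subst (E (wit β)) (single ox (trans (sym (mono (wit-off β) ox e)) (wit-side β))) e)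
    where open Separation S

every-vertex-near-Deg2 : ∀ {n} {E E′ : Fin n → Fin n → Set} → Critical E E′ → ∀ u →
  (∃₂ λ p b → Deg2 E p u b) ⊎ (∃₂ λ p b → Deg2 E′ p u b)
every-vertex-near-Deg2 C u with Critical.deletion C u
... | z , z≢u , inj₁ S = let p , d = Cuts.separation⇒Deg2 C (≢-sym z≢u) S in inj₁ (p , z , d)
... | z , z≢u , inj₂ S = let p , d = Cuts.separation⇒Deg2 (swap C) (≢-sym z≢u) S in inj₂ (p , z , d)

-- Counting vertices of degree two

unique-⊆⇒length≤ : ∀ {n} {xs ys : List (Fin n)} → Unique xs → (∀ {x} → x ∈ xs → x ∈ ys) →
                   length xs ≤ length ys
unique-⊆⇒length≤ {xs = xs} {ys} unique sub = injective⇒≤ {f = position} injective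
  where
  position : Fin (length xs) → Fin (length ys)
  position i = index (sub (∈-lookup i))
  lookup-injective : ∀ {zs : List _} → Unique zs → ∀ i j → List.lookup zs i ≡ List.lookup zs j → i ≡ j
  lookup-injective (_ ∷ _) zero zero _ = refl
  lookup-injective (p ∷ _) zero (suc j) eq = contradiction eq (All.lookup p (∈-lookup j))
  lookup-injective (p ∷ _) (suc i) zero eq = contradiction (sym eq) (All.lookup p (∈-lookup i))
  lookup-injective (_ ∷ u) (suc i) (suc j) eq = cong suc (lookup-injective u i j eq)
  injective : ∀ {i j} → position i ≡ position j → i ≡ j
  injective {i} {j} eq = lookup-injective unique i j
    (trans (lookup-index (sub (∈-lookup i)))
      (trans (cong (List.lookup ys) eq) (sym (lookup-index (sub (∈-lookup j))))))

sumOver : ∀ {A : Set} → (A → ℕ) → List A → ℕ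
sumOver f xs = sum (List.map f xs)

length-concatMap : ∀ {A B : Set} (f : A → List B) xs →
                   length (List.concatMap f xs) ≡ sumOver (length ∘ f) xs
length-concatMap f [] = refl
length-concatMap f (x ∷ xs) = trans (length-++ (f x)) (cong (length (f x) +_) (length-concatMap f xs))

sumOver-bound : ∀ {A : Set} (f g : A → ℕ) k xs → (∀ {x} → x ∈ xs → f x + g x ≤ k) →
              sumOver f xs + sumOver g xs ≤ length xs * k
sumOver-bound f g k [] _ = z≤n
sumOver-bound f g k (x ∷ xs) h = ≤-trans
  (≤-reflexive (solve 4 (λ a b c d → (a :+ c) :+ (b :+ d) := (a :+ b) :+ (c :+ d)) refl
    (f x) (g x) (sumOver f xs) (sumOver g xs)))
  (+-mono-≤ (h (here refl)) (sumOver-bound f g k xs (h ∘ there)))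
  where open +-*-Solver

count : ∀ {A : Set} {R : A → A → Set} → (∀ x y → Dec (R x y)) → A → List A → ℕ
count R? x ys = length (List.filter (R? x) ys)

module _ {A : Set} {R R′ : A → A → Set} (R? : ∀ x y → Dec (R x y)) (R′? : ∀ x y → Dec (R′ x y)) where

  count-step : ∀ x xs ys → (∀ {y} → y ∈ ys → R x y ⊎ R′ y x) →
    length ys + sumOver (λ y → count R′? y xs) ys ≤ count R? x ys + sumOver (λ y → count R′? y (x ∷ xs)) ys
  count-step x xs [] _ = z≤n
  count-step x xs (y ∷ ys) h = by (R? x y) (R′? y x)
    where
    open +-*-Solver
    a = count R′? y xs
    l = length ys
    b = sumOver (λ y → count R′? y xs) ys
    c = count R? x ys
    d = sumOver (λ y → count R′? y (x ∷ xs)) ys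
    ih : l + b ≤ c + d
    ih = count-step x xs ys (h ∘ there)
    a≤ : a ≤ count R′? y (x ∷ xs)
    a≤ with R′? y x
    ... | yes _ = n≤1+n a
    ... | no _ = ≤-refl
    move : suc l + (a + b) ≡ suc (a + (l + b))
    move = solve 3 (λ l a b → (con 1 :+ l) :+ (a :+ b) := con 1 :+ (a :+ (l :+ b))) refl l a b
    by : Dec (R x y) → Dec (R′ y x) →
         suc l + (a + b) ≤ count R? x (y ∷ ys) + (count R′? y (x ∷ xs) + d)
    by (yes r) _ rewrite filter-accept (R? x) {y} {ys} r = ≤-trans (≤-reflexive move)
      (≤-trans (s≤s (+-mono-≤ a≤ ih)) (≤-reflexive
        (solve 3 (λ e c d → con 1 :+ (e :+ (c :+ d)) := (con 1 :+ c) :+ (e :+ d)) refl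
          (count R′? y (x ∷ xs)) c d)))
    by (no ¬r) (no ¬r′) = ⊥-elim ([ ¬r , ¬r′ ]′ (h (here refl)))
    by (no ¬r) (yes r′)
      rewrite filter-reject (R? x) {y} {ys} ¬r | filter-accept (R′? y) {x} {xs} r′ =
      ≤-trans (≤-reflexive move) (≤-trans (s≤s (+-mono-≤ (≤-refl {a}) ih)) (≤-reflexive
        (solve 3 (λ a c d → con 1 :+ (a :+ (c :+ d)) := c :+ ((con 1 :+ a) :+ d)) refl a c d)))

  double-count : ∀ xs ys → (∀ {x y} → x ∈ xs → y ∈ ys → R x y ⊎ R′ y x) →
    length xs * length ys ≤ sumOver (λ x → count R? x ys) xs + sumOver (λ y → count R′? y xs) ys
  double-count [] ys h = z≤n
  double-count (x ∷ xs) ys h = ≤-trans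
    (+-mono-≤ (≤-refl {length ys}) (double-count xs ys (h ∘ there)))
    (≤-trans (≤-reflexive (solve 3 (λ l e f → l :+ (e :+ f) := (l :+ f) :+ e) refl
               (length ys) e (sumOver (λ y → count R′? y xs) ys)))
    (≤-trans (+-mono-≤ (count-step x xs ys (h (here refl))) (≤-refl {e}))
      (≤-reflexive (solve 3 (λ c d e → (c :+ d) :+ e := (c :+ e) :+ d) refl
        (count R? x ys) (sumOver (λ y → count R′? y (x ∷ xs)) ys) e))))
    where
    open +-*-Solver
    e = sumOver (λ x → count R? x ys) xs

-- If x and y are at least 3, then n ≤ 9 - (x - 3)(y - 3). Below that the two ratio bounds leave
-- finitely many cases; the value 10 comes from 2 and 4.
bounded-by-ten : ∀ n x y → n + x * y ≤ x * 3 + y * 3 → x ≤ y * 2 → y ≤ x * 2 → n ≤ 10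
bounded-by-ten n x y h x≤ y≤ = by x y h x≤ y≤
  where
  open +-*-Solver
  conclude : ∀ k {m} → n + k ≤ m → m ≤ 10 + k → n ≤ 10
  conclude k p q = +-cancelʳ-≤ k n 10 (≤-trans p q)
  auto : ∀ k m → {True (m ≤? 10 + k)} → n + k ≤ m → n ≤ 10
  auto k m {t} p = conclude k p (toWitness t)
  by : ∀ x y → n + x * y ≤ x * 3 + y * 3 → x ≤ y * 2 → y ≤ x * 2 → n ≤ 10
  by 0 0 p _ _ = auto 0 0 p
  by 0 (suc _) _ _ ()
  by (suc _) 0 _ () _
  by 1 1 p _ _ = auto 1 6 p
  by 1 2 p _ _ = auto 2 9 p
  by 1 (suc (suc (suc _))) _ _ (s≤s (s≤s ()))
  by 2 1 p _ _ = auto 2 9 p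
  by 2 2 p _ _ = auto 4 12 p
  by 2 3 p _ _ = auto 6 15 p
  by 2 4 p _ _ = auto 8 18 p
  by 2 (suc (suc (suc (suc (suc _))))) _ _ (s≤s (s≤s (s≤s (s≤s ()))))
  by (suc (suc (suc _))) 1 _ (s≤s (s≤s ())) _
  by 3 2 p _ _ = auto 6 15 p
  by 4 2 p _ _ = auto 8 18 p
  by (suc (suc (suc (suc (suc _))))) 2 _ (s≤s (s≤s (s≤s (s≤s ())))) _
  by (suc (suc (suc a))) (suc (suc (suc b))) p _ _ =
    conclude ((3 + a) * (3 + b)) p (≤-trans (m≤m+n _ (1 + a * b)) (≤-reflexive
      (solve 2 (λ a b → ((con 3 :+ a) :* con 3 :+ (con 3 :+ b) :* con 3) :+ (con 1 :+ a :* b)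
        := con 10 :+ (con 3 :+ a) :* (con 3 :+ b)) refl a b)))

-- Linked vertices and the final count

HasDeg2 : ∀ {n} → (Fin n → Fin n → Set) → Fin n → Set
HasDeg2 E v = ∃₂ λ a b → Deg2 E v a b

Linked : ∀ {n} → (Fin n → Fin n → Set) → (Fin n → Fin n → Set) → Fin n → Set
Linked E E′ v = HasDeg2 E v × ∃ λ p → HasDeg2 E′ p × E′ p v

module Linking {n} {E E′ : Fin n → Fin n → Set} (C : Critical E E′) where
  open Critical C
  open Basics C
  private module Co = Basics (swap C)

  hasDeg2? : ∀ v → Dec (HasDeg2 E v)
  hasDeg2? v with degree v
  ... | inj₁ d = yes d
  ... | inj₂ three = no λ { (_ , _ , d) → three⊈two three (Deg2.only d) }

  -- The degrees of a vertex in the two graphs add up to at least ten.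
  deg2-disjoint : ∀ {v} → HasDeg2 E v → ¬ HasDeg2 E′ v
  deg2-disjoint {v} (a , b , d) (a′ , b′ , d′) with pick! (v ∷ a ∷ b ∷ a′ ∷ b′ ∷ [])
  ... | x , xv ∷ xa ∷ xb ∷ xa′ ∷ xb′ ∷ [] with total (≢-sym xv)
  ...   | inj₁ e = [ xa , xb ]′ (Deg2.only d e)
  ...   | inj₂ e = [ xa′ , xb′ ]′ (Deg2.only d′ e)

  coHasDeg2? : ∀ v → Dec (HasDeg2 E′ v)
  coHasDeg2? v with Co.degree v
  ... | inj₁ d = yes d
  ... | inj₂ three = no λ { (_ , _ , d) → Co.three⊈two three (Deg2.only d) }

  linked? : ∀ v → Dec (Linked E E′ v)
  linked? v = hasDeg2? v ×-dec any? (λ p → coHasDeg2? p ×-dec Co.E? p v)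

  -- The first alternative of `codeg2-structure` would link `d`, so an `E`-neighbour `a` of `d` has
  -- `E′`-degree two and is `E′`-adjacent to the other neighbour `b`. Moreover `d` is adjacent to a
  -- vertex of degree two; one in `E′` would link `d`, and `a` has the wrong degree, so it is `b`.
  unlinked : ∀ {d} → HasDeg2 E d → ¬ Linked E E′ d →
    ∃₂ λ a b → Deg2 E d a b × HasDeg2 E b × Linked E E′ b × Linked E′ E a
  unlinked {d} hd@(_ , _ , D) ¬linked with Structure.codeg2-structure (swap C) D
  ... | inj₁ (p , c , D′) = contradiction (hd , p , (d , c , D′) , Deg2.va D′) ¬linked
  ... | inj₂ rest = [ (λ (_ , D′) → finish D D′) , (λ (_ , D′) → finish (flipDeg2 D) D′) ]′ rest
    where
    finish : ∀ {a b c} → Deg2 E d a b → Deg2 E′ a c b →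
             ∃₂ λ a b → Deg2 E d a b × HasDeg2 E b × Linked E E′ b × Linked E′ E a
    finish {a} {b} {c} D D′ with every-vertex-near-Deg2 C d
    ... | inj₂ (p , x , D″) = contradiction (hd , p , (d , x , D″) , Deg2.va D″) ¬linked
    ... | inj₁ (p , x , D″) with Deg2.only D (symm (Deg2.va D″))
    ...   | inj₁ refl = ⊥-elim (deg2-disjoint (d , x , D″) (c , b , D′))
    ...   | inj₂ refl = a , b , D , (d , x , D″) , ((d , x , D″) , a , (c , b , D′) , Deg2.vb D′) ,
                        ((c , b , D′) , d , hd , Deg2.va D)

  -- If `p` is not linked itself, `unlinked` shows that its two neighbours are, one of each kind.
  near-linked : ∀ {u p b} → Deg2 E p u b →
    Linked E E′ u ⊎ Linked E′ E u ⊎ ∃ λ d → Linked E E′ d × E d u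
  near-linked {u} {p} {b} D with linked? p
  ... | yes lp = inj₂ (inj₂ (p , lp , Deg2.va D))
  ... | no ¬lp with unlinked (u , b , D) ¬lp
  ...   | a , b′ , D′ , _ , lb , la with Deg2.only D′ (Deg2.va D)
  ...     | inj₁ refl = inj₂ (inj₁ la)
  ...     | inj₂ refl = inj₁ lb

  nbrs : Fin n → List (Fin n)
  nbrs v with degree v
  ... | inj₁ (a , b , _) = a ∷ b ∷ []
  ... | inj₂ _ = []

  nbrs-deg2 : ∀ {v} → HasDeg2 E v → ∃₂ λ a b → nbrs v ≡ a ∷ b ∷ [] × Deg2 E v a b
  nbrs-deg2 {v} (_ , _ , D) with degree v
  ... | inj₁ (a , b , d) = a , b , refl , d
  ... | inj₂ three = ⊥-elim (three⊈two three (Deg2.only D))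

  ∈-nbrs : ∀ {v u} → HasDeg2 E v → E v u → u ∈ nbrs v
  ∈-nbrs hv e with nbrs-deg2 hv
  ... | a , b , eq , d rewrite eq = [ here , there ∘ here ]′ (Deg2.only d e)

  length-nbrs : ∀ v → length (nbrs v) ≤ 2
  length-nbrs v with degree v
  ... | inj₁ _ = ≤-refl
  ... | inj₂ _ = z≤n

  linkedVertices : List (Fin n)
  linkedVertices = List.filter linked? (List.allFin n)

  ∈-linked⁺ : ∀ {v} → Linked E E′ v → v ∈ linkedVertices
  ∈-linked⁺ l = ∈-filter⁺ linked? (∈-allFin _) l

  ∈-linked⁻ : ∀ {v} → v ∈ linkedVertices → Linked E E′ v
  ∈-linked⁻ v∈ = proj₂ (∈-filter⁻ linked? {xs = List.allFin n} v∈)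

  unique-linked : Unique linkedVertices
  unique-linked = filter⁺ linked? (allFin⁺ n)

  -- Names the vertex for which `p` pays in `linked≤`: `p` itself, or its `E′`-neighbour of
  -- `E`-degree two.
  representative : Fin n → Fin n
  representative p with hasDeg2? p
  ... | yes _ = p
  ... | no _ with coHasDeg2? p
  ...   | no _ = p
  ...   | yes (a , b , _) with hasDeg2? a
  ...     | yes _ = a
  ...     | no _ = b

  representative-self : ∀ {p} → HasDeg2 E p → representative p ≡ p
  representative-self {p} h with hasDeg2? p
  ... | yes _ = refl
  ... | no ¬h = contradiction h ¬h

  representative-other : ∀ {p t s} → Deg2 E′ p t s → HasDeg2 E t → ¬ HasDeg2 E s →
                         representative p ≡ t
  representative-other {p} {t} {s} D ht ¬hs with hasDeg2? p
  ... | yes hp = ⊥-elim (deg2-disjoint hp (t , s , D))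
  ... | no _ with coHasDeg2? p
  ...   | no ¬h = contradiction (t , s , D) ¬h
  ...   | yes (a , b , D₁) with hasDeg2? a
  ...     | yes ha = [ id , (λ { refl → contradiction ha ¬hs }) ]′ (Deg2.only D (Deg2.va D₁))
  ...     | no ¬ha = [ (λ { refl → contradiction ht ¬ha }) , sym ]′ (Deg2.only D₁ (Deg2.va D))

module Counting {n} {E E′ : Fin n → Fin n → Set} (C : Critical E E′) (L′ : List (Fin n))
                (∈L′⁺ : ∀ {v} → Linked E′ E v → v ∈ L′) (unique-L′ : Unique L′) where
  open Critical C
  open Basics C
  open Linking C
  private
    module Co = Basics (swap C)
    module CoL = Linking (swap C)

  L : List (Fin n)
  L = linkedVertices

  -- Each of the at most two `E′`-neighbours of a vertex in `L′` pays for one vertex of `L`. Let `p`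
  -- witness that `d` is linked. If `p` is in `L′`, then `d` is one of these neighbours and pays for
  -- itself. If not, `unlinked` makes `p` a neighbour of some vertex of `L′`, and `d` is the only
  -- `E′`-neighbour of `p` with `E`-degree two.
  linked≤ : length L ≤ length L′ * 2
  linked≤ = ≤-trans (unique-⊆⇒length≤ unique-linked include) (≤-trans
    (≤-reflexive (trans (length-map representative (List.concatMap CoL.nbrs L′)) (length-concatMap CoL.nbrs L′)))
    (≤-trans (m≤m+n _ _) (sumOver-bound (length ∘ CoL.nbrs) (λ _ → 0) 2 L′ λ {x} _ →
      ≤-trans (≤-reflexive (+-identityʳ _)) (CoL.length-nbrs x))))
    where
    slot : ∀ {p s} → Linked E′ E s → E′ s p → representative p ∈ List.map representative (List.concatMap CoL.nbrs L′)
    slot {p} {s} ls e = ∈-map⁺ representative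
      (∈-concatMap⁺ CoL.nbrs (lose (∈L′⁺ ls) (CoL.∈-nbrs (proj₁ ls) e)))
    include : ∀ {d} → d ∈ L → d ∈ List.map representative (List.concatMap CoL.nbrs L′)
    include {d} d∈ with ∈-linked⁻ d∈
    ... | hd , p , hp , pd with CoL.linked? p
    ...   | yes lp = subst (_∈ _) (representative-self hd) (slot lp pd)
    ...   | no ¬lp with CoL.unlinked hp ¬lp
    ...     | t , s , D , hs , ls , (ht , _) with Deg2.only D pd
    ...       | inj₂ refl = ⊥-elim (deg2-disjoint hd hs)
    ...       | inj₁ refl = subst (_∈ _)
      (representative-other D ht (λ h → deg2-disjoint h hs)) (slot ls (symm′ (Deg2.vb D)))

  outside? : ∀ v → Dec (v ∉ L′)
  outside? v = ¬? (DecMembership._∈?_ _≟_ v L′)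

  private-nbrs : Fin n → List (Fin n)
  private-nbrs d = List.filter outside? (nbrs d)

  split-degree : ∀ {d} → d ∈ L → length (private-nbrs d) + count E? d L′ ≤ 2
  split-degree {d} d∈ with nbrs-deg2 (proj₁ (∈-linked⁻ d∈))
  ... | a , b , eq , D rewrite eq =
    subst (_≤ 2) (length-++ (List.filter outside? (a ∷ b ∷ [])))
      (unique-⊆⇒length≤ {ys = a ∷ b ∷ []}
        (++⁺ (filter⁺ outside? ((Deg2.a≢b D ∷ []) ∷ [] ∷ []))
             (filter⁺ (E? d) unique-L′)
             λ (x∈ , x∈′) → proj₂ (∈-filter⁻ outside? {xs = a ∷ b ∷ []} x∈)
                                   (proj₁ (∈-filter⁻ (E? d) {xs = L′} x∈′)))
        λ x∈ → [ (λ p → proj₁ (∈-filter⁻ outside? {xs = a ∷ b ∷ []} p))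
               , (λ p → [ here , there ∘ here ]′
                   (Deg2.only D (proj₂ (∈-filter⁻ (E? d) {xs = L′} p)))) ]′
               (∈-++⁻ (List.filter outside? (a ∷ b ∷ [])) x∈))

  private-cover : ∀ {d u} → Linked E E′ d → E d u → u ∈ L′ ⊎ u ∈ List.concatMap private-nbrs L
  private-cover {d} {u} ld e with outside? u
  ... | no u∈ = inj₁ (decidable-stable (DecMembership._∈?_ _≟_ u L′) u∈)
  ... | yes u∉ = inj₂ (∈-concatMap⁺ private-nbrs (lose (∈-linked⁺ ld)
    (∈-filter⁺ outside? (∈-nbrs (proj₁ ld) e) u∉)))

no-large-critical : ∀ {n} {E E′ : Fin n → Fin n → Set} → ¬ Critical E E′
no-large-critical {n} {E} {E′} C = <⇒≱ (Critical.large C)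
  (bounded-by-ten n x y bound A.linked≤ B.linked≤)
  where
  open Linking C
  open Linking (swap C) using () renaming
    (linkedVertices to coLinked; ∈-linked⁺ to ∈-coLinked⁺; ∈-linked⁻ to ∈-coLinked⁻;
     unique-linked to unique-coLinked; near-linked to near-coLinked)
  module A = Counting C coLinked ∈-coLinked⁺ unique-coLinked
  module B = Counting (swap C) linkedVertices ∈-linked⁺ unique-linked
  x = length A.L
  y = length B.L
  P = List.concatMap A.private-nbrs A.L
  Q = List.concatMap B.private-nbrs B.L
  covers : ∀ u → u ∈ A.L ++ B.L ++ P ++ Q
  covers u = [ side₁ , side₂ ]′ (every-vertex-near-Deg2 C u)
    where
    inA : u ∈ A.L → u ∈ A.L ++ B.L ++ P ++ Q
    inA = ∈-++⁺ˡ
    inB : u ∈ B.L → u ∈ A.L ++ B.L ++ P ++ Q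
    inB = ∈-++⁺ʳ A.L ∘ ∈-++⁺ˡ
    inP : u ∈ P → u ∈ A.L ++ B.L ++ P ++ Q
    inP = ∈-++⁺ʳ A.L ∘ ∈-++⁺ʳ B.L ∘ ∈-++⁺ˡ
    inQ : u ∈ Q → u ∈ A.L ++ B.L ++ P ++ Q
    inQ = ∈-++⁺ʳ A.L ∘ ∈-++⁺ʳ B.L ∘ ∈-++⁺ʳ P
    side₁ : (∃₂ λ p b → Deg2 E p u b) → u ∈ A.L ++ B.L ++ P ++ Q
    side₁ (_ , _ , D) =
      [ inA ∘ ∈-linked⁺
      , [ inB ∘ ∈-coLinked⁺ , (λ { (_ , ld , e) → [ inB , inP ]′ (A.private-cover ld e) }) ]′ ]′
      (near-linked D)
    side₂ : (∃₂ λ p b → Deg2 E′ p u b) → u ∈ A.L ++ B.L ++ P ++ Q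
    side₂ (_ , _ , D) =
      [ inB ∘ ∈-coLinked⁺
      , [ inA ∘ ∈-linked⁺ , (λ { (_ , ld , e) → [ inA , inQ ]′ (B.private-cover ld e) }) ]′ ]′
      (near-coLinked D)
  a = sumOver (length ∘ A.private-nbrs) A.L
  b = sumOver (length ∘ B.private-nbrs) B.L
  e = sumOver (λ d → count (Basics.E? C) d B.L) A.L
  e′ = sumOver (λ p → count (Basics.E? (swap C)) p A.L) B.L
  cover≤ : n ≤ x + (y + (a + b))
  cover≤ = ≤-trans (covering⇒≤ _ covers) (≤-reflexive
    (trans (length-++ A.L) (cong (x +_) (trans (length-++ B.L) (cong (y +_)
      (trans (length-++ P) (cong₂ _+_ (length-concatMap A.private-nbrs A.L)
                                      (length-concatMap B.private-nbrs B.L))))))))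
  pairs : x * y ≤ e + e′
  pairs = double-count (Basics.E? C) (Basics.E? (swap C)) A.L B.L λ {d} {p} d∈ p∈ →
    Sum.map₂ (Critical.symm′ C) (Critical.total C λ { refl →
      deg2-disjoint (proj₁ (∈-linked⁻ d∈)) (proj₁ (∈-coLinked⁻ p∈)) })
  -- Adds n ≤ x + y + a + b and x y ≤ e + e′, then applies a + e ≤ 2 x and b + e′ ≤ 2 y.
  bound : n + x * y ≤ x * 3 + y * 3
  bound = ≤-trans (+-mono-≤ cover≤ pairs) (≤-trans (≤-reflexive
    (solve 6 (λ x y a b e e′ → (x :+ (y :+ (a :+ b))) :+ (e :+ e′) :=
                               (x :+ (a :+ e)) :+ (y :+ (b :+ e′))) refl x y a b e e′))
    (≤-trans (+-mono-≤
      (+-mono-≤ (≤-refl {x}) (sumOver-bound _ _ 2 A.L A.split-degree))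
      (+-mono-≤ (≤-refl {y}) (sumOver-bound _ _ 2 B.L B.split-degree)))
    (≤-reflexive (solve 2 (λ x y → (x :+ x :* con 2) :+ (y :+ y :* con 2)
                                   := x :* con 3 :+ y :* con 3) refl x y))))
    where open +-*-Solver

-- Deletions and contractions of graphs

Edge : ∀ {n} → Graph n → Fin n → Fin n → Set
Edge G i j = adj G i j ≡ true

==-≢ : ∀ {n} {i j : Fin n} → i ≢ j → (i == j) ≡ false
==-≢ {i = i} {j} ne with i ≟ j
... | yes eq = contradiction eq ne
... | no _ = refl

adj-mkGraph : ∀ {n} (f : Fin n → Fin n → Bool) {i j} → i ≢ j →
              adj (mkGraph f) i j ≡ f i j ∨ f j i
adj-mkGraph f ne = cong (λ b → not b ∧ _) (==-≢ ne)

adj-compl : ∀ {n} (G : Graph n) {i j} → i ≢ j → adj (compl G) i j ≡ not (adj G i j)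
adj-compl G {i} {j} ne = trans (adj-mkGraph (λ i j → not (adj G i j)) ne)
  (trans (cong (λ b → not (adj G i j) ∨ not b) (adj-sym G j i)) (Bool.∨-idem _))

adj-induce : ∀ {k n} (f : Fin k → Fin n) (G : Graph n) i j →
             adj (induce f G) i j ≡ adj G (f i) (f j)
adj-induce f G i j with i ≟ j
... | yes refl = sym (adj-irr G (f i))
... | no _ = trans (cong (adj G (f i) (f j) ∨_) (adj-sym G (f j) (f i))) (Bool.∨-idem _)

edge-≢ : ∀ {n} (G : Graph n) {i j} → Edge G i j → i ≢ j
edge-≢ G e refl = contradiction (trans (sym e) (adj-irr G _)) λ ()

edge-sym : ∀ {n} (G : Graph n) {i j} → Edge G i j → Edge G j i
edge-sym G e = trans (adj-sym G _ _) e

edge? : ∀ {n} (G : Graph n) i j → Dec (Edge G i j)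
edge? G i j = adj G i j Bool.≟ true

compl-edge⁻ : ∀ {n} (G : Graph n) {i j} → Edge (compl G) i j → adj G i j ≡ false
compl-edge⁻ G e = Bool.not-injective (trans (sym (adj-compl G (edge-≢ (compl G) e))) e)

compl-edge⁺ : ∀ {n} (G : Graph n) {i j} → i ≢ j → ¬ Edge G i j → Edge (compl G) i j
compl-edge⁺ G ne ¬e = trans (adj-compl G ne) (cong not (Bool.¬-not ¬e))

compl-cong : ∀ {n} (G H : Graph n) → (∀ i j → adj G i j ≡ adj H i j) →
             ∀ i j → adj (compl G) i j ≡ adj (compl H) i j
compl-cong G H eq i j = cong₂ (λ a b → not (i == j) ∧ (not a ∨ not b)) (eq i j) (eq j i)

mapWalk : ∀ {m n} {G : Graph m} {H : Graph n} (f : Fin m → Fin n) →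
          (∀ {i j} → Edge G i j → Edge H (f i) (f j)) → ∀ {i j} → Walk G i j → Walk H (f i) (f j)
mapWalk f h here = here
mapWalk f h (step e w) = step (h e) (mapWalk f h w)

TwoConnected-cong : ∀ {n} (G H : Graph n) → (∀ i j → adj G i j ≡ adj H i j) →
                    TwoConnected G → TwoConnected H
TwoConnected-cong {suc n} G H eq (large , conn , conn-delete) =
  large ,
  (λ i j → mapWalk {G = G} {H} id (λ {a} {b} e → trans (sym (eq a b)) e) (conn i j)) ,
  λ v i j → mapWalk {G = delete G v} {delete H v} id
    (λ {a} {b} e → trans (adj-induce (punchIn v) H a b)
      (trans (sym (eq _ _)) (trans (sym (adj-induce (punchIn v) G a b)) e)))
    (conn-delete v i j)

-- Connectivity and cut vertices of graphs

record Disconnection {n} (G : Graph n) : Set where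
  field
    side     : Fin n → Bool
    wit      : Bool → Fin n
    wit-side : ∀ β → side (wit β) ≡ β
    mono     : ∀ {i j} → Edge G i j → side i ≡ side j

connected⇒¬disconnection : ∀ {n} {G : Graph n} → Connected G → ¬ Disconnection G
connected⇒¬disconnection {G = G} conn D =
  contradiction (trans (sym (wit-side true)) (trans (along (conn _ _)) (wit-side false))) λ ()
  where
  open Disconnection D
  along : ∀ {i j} → Walk G i j → side i ≡ side j
  along here = refl
  along (step e w) = trans (mono e) (along w)

snoc : ∀ {n} {G : Graph n} {i j k} → Walk G i j → Edge G j k → Walk G i k
snoc here e = step e here
snoc (step e w) e′ = step e (snoc w e′)

size-bound : ∀ {n} (P : Fin n → Bool) → size P ≤ n
size-bound {zero} P = z≤n
size-bound {suc n} P with P zero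
... | true = s≤s (size-bound (P ∘ suc))
... | false = m≤n⇒m≤1+n (size-bound (P ∘ suc))

record Component {n} (G : Graph n) (i : Fin n) : Set where
  field
    set    : Fin n → Bool
    base   : set i ≡ true
    walks  : ∀ {j} → set j ≡ true → Walk G i j
    closed : ∀ {a b} → set a ≡ true → Edge G a b → set b ≡ true

-- Closure under adjacency with fuel n: each round adds a vertex, as the invariant n ≤ k + size R
-- records.
component : ∀ {n} (G : Graph n) i → Component G i
component {n} G i = grow n (i ==_) (==-refl i) start (m≤m+n n _)
  where
  start : ∀ {j} → (i == j) ≡ true → Walk G i j
  start {j} eq with i ≟ j
  ... | yes refl = here
  grow : ∀ k (R : Fin n → Bool) → R i ≡ true → (∀ {j} → R j ≡ true → Walk G i j) →
         n ≤ k + size R → Component G i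
  grow k R base walks enough
    with any? (λ a → any? λ b → (R a Bool.≟ true) ×-dec (R b Bool.≟ false) ×-dec edge? G a b)
  ... | no none = record { set = R ; base = base ; walks = walks
    ; closed = λ {a} {b} ra e → decidable-stable (R b Bool.≟ true) λ nb →
        none (a , b , ra , Bool.¬-not nb , e) }
  ... | yes (a , b , ra , rb , e) = continue k enough
    where
    R⁺ : Fin n → Bool
    R⁺ j = R j ∨ (b == j)
    sub : ∀ j → R j ≡ true → R⁺ j ≡ true
    sub j rj rewrite rj = refl
    larger : size R < size R⁺
    larger = size-strict sub b (trans (cong (R b ∨_) (==-refl b)) (Bool.∨-zeroʳ (R b))) rb
    walks⁺ : ∀ {j} → R⁺ j ≡ true → Walk G i j
    walks⁺ {j} r with R j in rj | b ≟ j
    ... | true | _ = walks rj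
    ... | false | yes refl = snoc (walks ra) e
    continue : ∀ k → n ≤ k + size R → Component G i
    continue zero enough = contradiction (size-bound R⁺) (<⇒≱ (≤-trans (s≤s enough) larger))
    continue (suc k) enough = grow k R⁺ (sub i base) walks⁺
      (≤-trans enough (≤-trans (≤-reflexive (sym (+-suc k (size R)))) (+-mono-≤ (≤-refl {k}) larger)))

search : ∀ {n} {A B : Fin n → Set} → (∀ i → A i ⊎ B i) → (∀ i → A i) ⊎ ∃ B
search {zero} f = inj₁ λ ()
search {suc n} f with f zero | search (f ∘ suc)
... | inj₂ b | _ = inj₂ (zero , b)
... | _ | inj₂ (i , b) = inj₂ (suc i , b)
... | inj₁ a | inj₁ as = inj₁ λ { zero → a ; (suc i) → as i }

connected? : ∀ {n} (G : Graph n) → Connected G ⊎ Disconnection G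
connected? G with search (λ i → search (decide i))
  where
  decide : ∀ i j → Walk G i j ⊎ Component.set (component G i) j ≡ false
  decide i j with Component.set (component G i) j in eq
  ... | true = inj₁ (Component.walks (component G i) eq)
  ... | false = inj₂ refl
... | inj₁ conn = inj₁ conn
... | inj₂ (i , j , out) = inj₂ record
  { side = set ; wit = λ { true → i ; false → j } ; wit-side = λ { true → base ; false → out }
  ; mono = same }
  where
  open Component (component G i)
  same : ∀ {a b} → Edge G a b → set a ≡ set b
  same {a} {b} e with set a in ra | set b in rb
  ... | true | true = refl
  ... | false | false = refl
  ... | true | false = trans (sym (closed ra e)) rb
  ... | false | true = trans (sym ra) (closed rb (edge-sym G e))

offPoint : ∀ {m} {v i : Fin (suc m)} → i ≢ v → ∃ λ k → punchIn v k ≡ i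
offPoint i≢v = punchOut (≢-sym i≢v) , punchIn-punchOut (≢-sym i≢v)

extend : ∀ {m} → Fin (suc m) → Bool → (Fin m → Bool) → Fin (suc m) → Bool
extend v β f i with i ≟ v
... | yes _ = β
... | no i≢v = f (proj₁ (offPoint i≢v))

extend-punchIn : ∀ {m} (v : Fin (suc m)) β f k → extend v β f (punchIn v k) ≡ f k
extend-punchIn v β f k with punchIn v k ≟ v
... | yes eq = contradiction eq (punchInᵢ≢i v k)
... | no ne = cong f (punchIn-injective v _ k (proj₂ (offPoint ne)))

extend-base : ∀ {m} (v : Fin (suc m)) β f → extend v β f v ≡ β
extend-base v β f with v ≟ v
... | yes _ = refl
... | no ne = contradiction refl ne

lift-separation : ∀ {m} {R : Fin m → Fin m → Set} {E : Fin (suc m) → Fin (suc m) → Set} (y : Fin (suc m)) →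
  (∀ {i j} → E (punchIn y i) (punchIn y j) → R i j) →
  ∀ {c} → Separation R c c → Separation E y (punchIn y c)
lift-separation {E = E} y h {c} S = record
  -- The vertex `y` belongs to the cut, so its label is arbitrary.
  { side = extend y true side
  ; wit = λ β → punchIn y (wit β)
  ; wit-off = λ β → punchInᵢ≢i y _ , proj₁ (wit-off β) ∘ punchIn-injective y _ _
  ; wit-side = λ β → trans (extend-punchIn y true side (wit β)) (wit-side β)
  ; mono = same }
  where
  open Separation S
  same : ∀ {i j} → Off y (punchIn y c) i → Off y (punchIn y c) j → E i j →
         extend y true side i ≡ extend y true side j
  same (iy , ic) (jy , jc) e with offPoint iy | offPoint jy
  ... | i , refl | j , refl =
    trans (extend-punchIn y true side i)
      (trans (mono (ic ∘ cong (punchIn y) , ic ∘ cong (punchIn y))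
                   (jc ∘ cong (punchIn y) , jc ∘ cong (punchIn y)) (h e))
        (sym (extend-punchIn y true side j)))

twoConnected⇒noCut : ∀ {m} {G : Graph (suc m)} → TwoConnected G → ∀ c → ¬ Separation (Edge G) c c
twoConnected⇒noCut {m} {G} (_ , _ , conn) c S = connected⇒¬disconnection (conn c) record
  { side = side ∘ punchIn c
  ; wit = λ β → proj₁ (offPoint (proj₁ (wit-off β)))
  ; wit-side = λ β → trans (cong side (proj₂ (offPoint (proj₁ (wit-off β))))) (wit-side β)
  ; mono = λ {i} {j} e → mono (punchInᵢ≢i c i , punchInᵢ≢i c i) (punchInᵢ≢i c j , punchInᵢ≢i c j)
      (trans (sym (adj-induce (punchIn c) G i j)) e) }
  where open Separation S

twoConnected? : ∀ {m} (G : Graph (suc m)) → 3 ≤ suc m → TwoConnected G ⊎ ∃ λ c → Separation (Edge G) c c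
twoConnected? {m} G large with search (λ v → connected? (delete G v))
... | inj₁ conn = inj₁ (large , connected , conn)
  where
  connected : Connected G
  -- Any two vertices survive the deletion of a third one.
  connected i j with fresh (i ∷ j ∷ []) large
  ... | v , vi ∷ vj ∷ [] with offPoint (≢-sym vi) | offPoint (≢-sym vj)
  ...   | i′ , refl | j′ , refl = mapWalk {G = delete G v} (punchIn v)
    (λ {a} {b} e → trans (sym (adj-induce (punchIn v) G a b)) e) (conn v i′ j′)
... | inj₂ (v , D) = inj₂ (v , record
  { side = extend v true side
  ; wit = λ β → punchIn v (wit β)
  ; wit-off = λ β → punchInᵢ≢i v _ , punchInᵢ≢i v _
  ; wit-side = λ β → trans (extend-punchIn v true side (wit β)) (wit-side β)
  ; mono = λ (iv , _) (jv , _) → same iv jv })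
  where
  open Disconnection D
  same : ∀ {i j} → i ≢ v → j ≢ v → Edge G i j → extend v true side i ≡ extend v true side j
  same iv jv e with offPoint iv | offPoint jv
  ... | i , refl | j , refl = trans (extend-punchIn v true side i)
    (trans (mono (trans (adj-induce (punchIn v) G i j) e)) (sym (extend-punchIn v true side j)))

twoCograph-cut : ∀ {m} (H : Graph (suc m)) → 3 ≤ suc m → TwoCograph H →
  (∃ λ c → Separation (Edge H) c c) ⊎ (∃ λ c → Separation (Edge (compl H)) c c)
twoCograph-cut H large cograph with twoConnected? H large | twoConnected? (compl H) large
... | inj₂ S | _ = inj₁ S
... | _ | inj₂ S = inj₂ S
... | inj₁ tc | inj₁ tc′ = ⊥-elim (cograph
  (_ , id , id , TwoConnected-cong H (induce id H) eq tc ,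
   TwoConnected-cong (compl H) (compl (induce id H)) (compl-cong H (induce id H) eq) tc′))
  where
  eq : ∀ i j → adj H i j ≡ adj (induce id H) i j
  eq i j = sym (adj-induce id H i j)

pull-cut : ∀ {k n} (H : Graph k) (f : Fin k → Fin n) → (∀ {i j} → f i ≡ f j → i ≡ j) →
  (∀ v → ∃ λ i → f i ≡ v) → ∀ {E : Fin n → Fin n → Set} → (∀ {i j} → Edge H i j → E (f i) (f j)) →
  ∀ {c} → Separation E c c → ¬ TwoConnected H
pull-cut {zero} H f inj pre h {c} S tc = ⊥-elim tc
pull-cut {suc k} H f inj pre h {c} S tc with pre c
... | c′ , refl = twoConnected⇒noCut tc c′ record
  { side = side ∘ f
  ; wit = λ β → proj₁ (pre (wit β))
  ; wit-off = λ β → off β , off β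
  ; wit-side = λ β → trans (cong side (proj₂ (pre (wit β)))) (wit-side β)
  ; mono = λ (ic , _) (jc , _) e → mono (ic ∘ inj , ic ∘ inj) (jc ∘ inj , jc ∘ inj) (h e) }
  where
  open Separation S
  off : ∀ β → proj₁ (pre (wit β)) ≢ c′
  off β eq = proj₁ (wit-off β) (trans (sym (proj₂ (pre (wit β)))) (cong f eq))

-- A forbidden induced subgraph that misses a vertex lies in a vertex-deleted subgraph; one that
-- misses none is a copy of `G` and inherits the cut.
cut⇒twoCograph : ∀ {m} (G : Graph (suc m)) → (∀ v → TwoCograph (delete G v)) → ∀ {c} →
  Separation (Edge G) c c ⊎ Separation (Edge (compl G)) c c → TwoCograph G
cut⇒twoCograph {m} G del-cograph {c} cut (k , f , inj , tc , tc′)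
  with any? (λ v → all? λ i → ¬? (f i ≟ v))
... | yes (v , missed) = del-cograph v (k , g , g-inj ,
    TwoConnected-cong (induce f G) (induce g (delete G v)) eq tc ,
    TwoConnected-cong (compl (induce f G)) (compl (induce g (delete G v)))
      (compl-cong (induce f G) (induce g (delete G v)) eq) tc′)
  where
  g : Fin k → Fin m
  g i = proj₁ (offPoint (missed i))
  g-eq : ∀ i → punchIn v (g i) ≡ f i
  g-eq i = proj₂ (offPoint (missed i))
  g-inj : ∀ {i j} → g i ≡ g j → i ≡ j
  g-inj {i} {j} eq = inj (trans (sym (g-eq i)) (trans (cong (punchIn v) eq) (g-eq j)))
  eq : ∀ i j → adj (induce f G) i j ≡ adj (induce g (delete G v)) i j
  eq i j = trans (adj-induce f G i j) (sym (trans (adj-induce g (delete G v) i j)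
    (trans (adj-induce (punchIn v) G (g i) (g j)) (cong₂ (adj G) (g-eq i) (g-eq j)))))
... | no none = [ (λ S → pull-cut (induce f G) f inj preimage
                          (λ {i} {j} e → trans (sym (adj-induce f G i j)) e) S tc)
                , (λ S → pull-cut (compl (induce f G)) f inj preimage co-edge S tc′) ]′ cut
  where
  preimage : ∀ v → ∃ λ i → f i ≡ v
  preimage v = decidable-stable (any? λ i → f i ≟ v) λ h → none (v , λ i eq → h (i , eq))
  co-edge : ∀ {i j} → Edge (compl (induce f G)) i j → Edge (compl G) (f i) (f j)
  co-edge {i} {j} e = compl-edge⁺ G (edge-≢ (compl (induce f G)) e ∘ inj) λ h →
    contradiction (trans (sym (trans (adj-induce f G i j) h)) (compl-edge⁻ (induce f G) e)) λ ()

-- Contraction of an edge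

contract-edge⁻ : ∀ {m} (G : Graph (suc m)) u v {i j} → Edge (contract G u v) i j →
  Edge G (punchIn v i) (punchIn v j) ⊎
  (punchIn v i ≡ u × Edge G v (punchIn v j)) ⊎ (punchIn v j ≡ u × Edge G v (punchIn v i))
contract-edge⁻ {m} G u v {i} {j} e =
  [ [ inj₁ , inj₂ ∘ inj₁ ]′ ∘ half , [ inj₁ ∘ edge-sym G , inj₂ ∘ inj₂ ]′ ∘ half ]′
  (either (trans (sym (adj-mkGraph merged (edge-≢ (contract G u v) e))) e))
  where
  merged : Fin m → Fin m → Bool
  merged i j = adj G (punchIn v i) (punchIn v j) ∨ ((punchIn v i == u) ∧ adj G v (punchIn v j))
  either : ∀ {a b} → a ∨ b ≡ true → a ≡ true ⊎ b ≡ true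
  either {true} _ = inj₁ refl
  either {false} eq = inj₂ eq
  half : ∀ {i j} → merged i j ≡ true →
         Edge G (punchIn v i) (punchIn v j) ⊎ (punchIn v i ≡ u × Edge G v (punchIn v j))
  half {i} {j} h with either {adj G (punchIn v i) (punchIn v j)} h
  ... | inj₁ e = inj₁ e
  ... | inj₂ e with punchIn v i ≟ u
  ...   | yes eq = inj₂ (eq , e)

contract-edge⁺ : ∀ {m} (G : Graph (suc m)) u v {i j} → i ≢ j →
  Edge G (punchIn v i) (punchIn v j) ⊎ (punchIn v i ≡ u × Edge G v (punchIn v j)) →
  Edge (contract G u v) i j
contract-edge⁺ {m} G u v {i} {j} ne h = trans (adj-mkGraph merged ne) (cong (_∨ merged j i) (now h))
  where
  merged : Fin m → Fin m → Bool
  merged i j = adj G (punchIn v i) (punchIn v j) ∨ ((punchIn v i == u) ∧ adj G v (punchIn v j))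
  now : Edge G (punchIn v i) (punchIn v j) ⊎ (punchIn v i ≡ u × Edge G v (punchIn v j)) →
        merged i j ≡ true
  now (inj₁ e) = cong (_∨ ((punchIn v i == u) ∧ adj G v (punchIn v j))) e
  now (inj₂ (refl , e)) = trans (cong (adj G (punchIn v i) (punchIn v j) ∨_)
    (cong₂ _∧_ (==-refl (punchIn v i)) e)) (Bool.∨-zeroʳ _)

-- If the merged vertex is the cut vertex, then `u` and `v` together cut `G`. Any other cut vertex
-- would be one of `G` already, with `v` put on the side of `u`.
contract-cut : ∀ {m} (G : Graph (suc m)) {u v} → Edge G u v → (∀ c → ¬ Separation (Edge G) c c) →
  (∃ λ c → Separation (Edge (contract G u v)) c c) → Separation (Edge G) u v
contract-cut G {u} {v} uv noCut (c , S) with punchIn v c ≟ u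
... | yes refl = swapSep (lift-separation {R = Edge (contract G u v)} v
  (λ e → contract-edge⁺ G u v (λ { refl → edge-≢ G e refl }) (inj₁ e)) S)
... | no c≢u = ⊥-elim (noCut (punchIn v c) record
  { side = side⁺
  ; wit = λ β → punchIn v (wit β)
  ; wit-off = λ β → let ne = proj₁ (wit-off β) ∘ punchIn-injective v _ _ in ne , ne
  ; wit-side = λ β → trans (on (wit β)) (wit-side β)
  ; mono = λ (ic , _) (jc , _) e → same ic jc e })
  where
  open Separation S
  u≢v : u ≢ v
  u≢v = edge-≢ G uv
  u′ = proj₁ (offPoint u≢v)
  u′-eq : punchIn v u′ ≡ u
  u′-eq = proj₂ (offPoint u≢v)
  u′≢c : u′ ≢ c
  u′≢c eq = c≢u (trans (sym (cong (punchIn v) eq)) u′-eq)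
  side⁺ : Fin _ → Bool
  side⁺ = extend v (side u′) side
  on : ∀ k → side⁺ (punchIn v k) ≡ side k
  on = extend-punchIn v (side u′) side
  at-v : side⁺ v ≡ side u′
  at-v = extend-base v (side u′) side
  from-v : ∀ {j} → punchIn v j ≢ punchIn v c → Edge G v (punchIn v j) → side u′ ≡ side j
  from-v {j} jc e with u′ ≟ j
  ... | yes refl = refl
  ... | no ne = mono (u′≢c , u′≢c) (jc ∘ cong (punchIn v) , jc ∘ cong (punchIn v))
    (contract-edge⁺ G u v ne (inj₂ (u′-eq , e)))
  same : ∀ {i j} → i ≢ punchIn v c → j ≢ punchIn v c → Edge G i j → side⁺ i ≡ side⁺ j
  same {i} {j} ic jc e = by (i ≟ v) (j ≟ v)
    where
    by : Dec (i ≡ v) → Dec (j ≡ v) → side⁺ i ≡ side⁺ j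
    by (yes refl) (yes refl) = refl
    by (yes refl) (no jv) with offPoint jv
    ... | j′ , refl = trans at-v (trans (from-v jc e) (sym (on j′)))
    by (no iv) (yes refl) with offPoint iv
    ... | i′ , refl = trans (on i′) (trans (sym (from-v ic (edge-sym G e))) (sym at-v))
    by (no iv) (no jv) with offPoint iv | offPoint jv
    ... | i′ , refl | j′ , refl = trans (on i′) (trans
      (mono (ic ∘ cong (punchIn v) , ic ∘ cong (punchIn v)) (jc ∘ cong (punchIn v) , jc ∘ cong (punchIn v))
        (contract-edge⁺ G u v (λ { refl → edge-≢ G e refl }) (inj₁ e))) (sym (on j′)))

-- In the complement of the contraction the merged vertex is adjacent only to the common
-- non-neighbours of `u` and `v`; this is the source of the two side conditions in `ContractionCut`.
contract-cocut : ∀ {m} (G : Graph (suc m)) {u v} {F : Fin (suc m) → Fin (suc m) → Set} →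
  (∀ {i j} → F i j → i ≢ j × adj G i j ≡ false) →
  (∃ λ c → Separation (Edge (compl (contract G u v))) c c) →
  ∃ λ c → c ≢ v × ContractionCut F u v c
contract-cocut G {u} {v} {F} nonedge (c , S) = punchIn v c , punchInᵢ≢i v c , record
  { side = extend v true side
  ; wit = λ β → punchIn v (wit β)
  ; wit-off = λ β → punchInᵢ≢i v _ , proj₁ (wit-off β) ∘ punchIn-injective v _ _
  ; wit-side = λ β → trans (extend-punchIn v true side (wit β)) (wit-side β)
  ; mono = same }
  where
  open Separation S
  apart : ∀ {i j} → F i j → ¬ Edge G i j
  apart f e = contradiction (trans (sym e) (proj₂ (nonedge f))) λ ()
  same : ∀ {i j} → Off v (punchIn v c) i → Off v (punchIn v c) j → F i j →
         (i ≡ u → F v j) → (j ≡ u → F v i) → extend v true side i ≡ extend v true side j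
  same (iv , ic) (jv , jc) f fi fj with offPoint iv | offPoint jv
  ... | i , refl | j , refl = trans (extend-punchIn v true side i) (trans
    (mono (ic ∘ cong (punchIn v) , ic ∘ cong (punchIn v)) (jc ∘ cong (punchIn v) , jc ∘ cong (punchIn v))
      (compl-edge⁺ (contract G u v) (λ { refl → proj₁ (nonedge f) refl }) λ e →
        [ apart f , [ (λ (eq , e) → apart (fi eq) e) , (λ (eq , e) → apart (fj eq) e) ]′ ]′
        (contract-edge⁻ G u v e)))
    (sym (extend-punchIn v true side j)))

-- Minimal graphs and the two bounds

IsMinimal : ∀ {n} → Graph n → Set
IsMinimal {n} G = ¬ TwoCograph G ×
  (∀ (k : ℕ) (H : Graph k) → ProperInducedMinor G H → TwoCograph H) ×
  (∀ (k : ℕ) (H : Graph k) → ProperInducedMinor (compl G) H → TwoCograph H)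

minimal⇒noCut : ∀ {m} {G : Graph (suc m)} → IsMinimal G → ∀ c →
  ¬ (Separation (Edge G) c c ⊎ Separation (Edge (compl G)) c c)
minimal⇒noCut {G = G} (not-cograph , minors , _) c cut =
  not-cograph (cut⇒twoCograph G (λ v → minors _ _ (one (del G v))) cut)

-- Deletion commutes with complementation, so the deletions of `G` serve both graphs. Contraction
-- does not, and `contraction′` draws on the induced minors of the complement.
minimal⇒critical : ∀ {m} (G : Graph (suc m)) → 11 ≤ suc m → IsMinimal G →
                   Critical (Edge G) (Edge (compl G))
minimal⇒critical {zero} _ (s≤s ())
minimal⇒critical {suc m} G large minimal@(_ , minors , minors′) = record
  { large = large
  ; irr = λ e → edge-≢ G e refl
  ; irr′ = λ e → edge-≢ (compl G) e refl
  ; symm = edge-sym G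
  ; symm′ = edge-sym (compl G)
  ; excl = λ e e′ → contradiction (trans (sym e) (compl-edge⁻ G e′)) λ ()
  ; total = total-edge
  ; noCut = noCut
  ; noCut′ = noCut′
  ; deletion = deletion
  ; contraction = λ {u} {v} e → Sum.map (contract-cut G e noCut)
      (contract-cocut G λ f → edge-≢ (compl G) f , compl-edge⁻ G f)
      (twoCograph-cut (contract G u v) three≤ (minors _ _ (one (con G u v e))))
  ; contraction′ = λ {u} {v} e → Sum.map (contract-cut (compl G) e noCut′)
      (contract-cocut (compl G) λ f → edge-≢ G f , trans (adj-compl G (edge-≢ G f)) (cong not f))
      (twoCograph-cut (contract (compl G) u v) three≤ (minors′ _ _ (one (con (compl G) u v e)))) }
  where
  three≤ : 3 ≤ suc m
  three≤ = ≤-trans (m≤m+n 3 7) (s≤s⁻¹ large)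
  noCut : ∀ c → ¬ Separation (Edge G) c c
  noCut c = minimal⇒noCut minimal c ∘ inj₁
  noCut′ : ∀ c → ¬ Separation (Edge (compl G)) c c
  noCut′ c = minimal⇒noCut minimal c ∘ inj₂
  total-edge : ∀ {i j} → i ≢ j → Edge G i j ⊎ Edge (compl G) i j
  total-edge {i} {j} ne with edge? G i j
  ... | yes e = inj₁ e
  ... | no ¬e = inj₂ (compl-edge⁺ G ne ¬e)
  deletion : ∀ y → ∃ λ z → z ≢ y × (Separation (Edge G) y z ⊎ Separation (Edge (compl G)) y z)
  deletion y = [ (λ (c , S) → punchIn y c , punchInᵢ≢i y c , inj₁ (lift-separation y
                   (λ {i} {j} e → trans (adj-induce (punchIn y) G i j) e) S))
               , (λ (c , S) → punchIn y c , punchInᵢ≢i y c , inj₂ (lift-separation y co-edge S)) ]′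
    (twoCograph-cut (delete G y) three≤ (minors _ _ (one (del G y))))
    where
    co-edge : ∀ {i j} → Edge (compl G) (punchIn y i) (punchIn y j) → Edge (compl (delete G y)) i j
    co-edge {i} {j} e = compl-edge⁺ (delete G y) (λ { refl → edge-≢ (compl G) e refl }) λ h →
      contradiction (trans (sym (trans (sym (adj-induce (punchIn y) G i j)) h)) (compl-edge⁻ G e)) λ ()

first-step : ∀ {n} {G : Graph n} {i j} → i ≢ j → Walk G i j → ∃ λ x → Edge G i x
first-step ne here = contradiction refl ne
first-step ne (step e _) = _ , e

neighbour-avoiding : ∀ {m} (G : Graph (suc m)) → TwoConnected G → ∀ {v c} → v ≢ c →
                     ∃ λ x → x ≢ c × Edge G v x
neighbour-avoiding G (large , _ , conn) {v} {c} v≢c with fresh (v ∷ c ∷ []) large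
... | j , jv ∷ jc ∷ [] with offPoint v≢c | offPoint jc
...   | v′ , refl | j′ , refl with first-step (λ { refl → jv refl }) (conn c v′ j′)
...     | x , e = punchIn c x , punchInᵢ≢i c x , trans (sym (adj-induce (punchIn c) G v′ x)) e

two-neighbours : ∀ {m} (G : Graph (suc m)) → TwoConnected G → ∀ v →
                 ∃₂ λ a b → a ≢ b × Edge G v a × Edge G v b
two-neighbours G tc@(large , _) v with fresh (v ∷ []) (≤-trans (s≤s (s≤s z≤n)) large)
... | c , cv ∷ [] with neighbour-avoiding G tc (≢-sym cv)
...   | a , _ , va with neighbour-avoiding G tc (edge-≢ G va)
...     | b , b≢a , vb = a , b , ≢-sym b≢a , va , vb

-- Both graphs are 2-connected, so a vertex has two neighbours in each of them, and these four are
-- distinct.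
five≤ : ∀ {n} (G : Graph n) → IsMinimal G → 5 ≤ n
five≤ {n} G minimal with 3 ≤? n
... | no small = contradiction
  (λ (k , f , inj , tc , _) → small (≤-trans (three≤ k (induce f G) tc) (injective⇒≤ inj))) (proj₁ minimal)
  where
  three≤ : ∀ k (H : Graph k) → TwoConnected H → 3 ≤ k
  three≤ (suc k) H (large , _) = large
five≤ {suc m} G minimal | yes large
  with twoConnected? G large | twoConnected? (compl G) large
... | inj₂ (c , S) | _ = ⊥-elim (minimal⇒noCut minimal c (inj₁ S))
... | inj₁ _ | inj₂ (c , S) = ⊥-elim (minimal⇒noCut minimal c (inj₂ S))
... | inj₁ tc | inj₁ tc′ with two-neighbours G tc zero | two-neighbours (compl G) tc′ zero
...   | a , b , a≢b , ea , eb | a′ , b′ , a′≢b′ , ea′ , eb′ =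
  ≤-trans (unique-⊆⇒length≤ {xs = zero ∷ a ∷ b ∷ a′ ∷ b′ ∷ []}
    ((edge-≢ G ea ∷ edge-≢ G eb ∷ edge-≢ (compl G) ea′ ∷ edge-≢ (compl G) eb′ ∷ []) ∷
     (a≢b ∷ apart ea ea′ ∷ apart ea eb′ ∷ []) ∷
     (apart eb ea′ ∷ apart eb eb′ ∷ []) ∷ (a′≢b′ ∷ []) ∷ [] ∷ [])
    (λ _ → ∈-allFin _)) (≤-reflexive (length-tabulate id))
  where
  apart : ∀ {i j} → Edge G zero i → Edge (compl G) zero j → i ≢ j
  apart e e′ refl = contradiction (trans (sym e) (compl-edge⁻ G e′)) λ ()

theorem1p2 : ∀ (n : ℕ) (G : Graph n) →
    ¬ TwoCograph G →
    (∀ (k : ℕ) (H : Graph k) → ProperInducedMinor G H → TwoCograph H) →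
    (∀ (k : ℕ) (H : Graph k) → ProperInducedMinor (compl G) H → TwoCograph H) →
    5 ≤ n × n ≤ 10
theorem1p2 n G not-cograph minors minors′ = five≤ G minimal , ten n G minimal
  where
  minimal : IsMinimal G
  minimal = not-cograph , minors , minors′
  ten : ∀ n (G : Graph n) → IsMinimal G → n ≤ 10
  ten zero _ _ = z≤n
  ten (suc m) G minimal = ≮⇒≥ λ large → no-large-critical (minimal⇒critical G large minimal)
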